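{- The $\mathrm{FO}^2$-covering problem is decidable.
   Context: $A$ is a fixed finite alphabet; languages are subsets of $A^*$. **The class $\mathrm{FO}^2$.** A word is viewed as a (possibly empty) linearly ordered sequence of positions labeled over $A$; first-order sentences use unary predicates $P_a$ ($a\in A$) and the strict order $<$. $\mathrm{FO}^2$ sentences are those using at most two distinct variable names (which may be requantified). $\mathrm{FO}^2$ also denotes the class of languages over $A$ definable by such sentences. **Covering.** For a class $\mathcal{C}$ and a language $L$, a $\mathcal{C}$-cover of $L$ is a finite set $\mathbf{K}$ of languages belonging to $\mathcal{C}$ with $L\subseteq\bigcup_{K\in\mathbf{K}}K$. A set $\mathbf{K}$ of languages is separating for a finite multiset of languages $\mathbf{L}$ if for every $K\in\mathbf{K}$ there exists $L'\in\mathbf{L}$ with $K\cap L'=\emptyset$. The pair $(L,\mathbf{L})$ is $\mathcal{C}$-coverable if there is a $\mathcal{C}$-cover of $L$ that is separating for $\mathbf{L}$. The $\mathcal{C}$-covering problem: given as input a regular language $L$ and a finite multiset $\mathbf{L}$ of regular languages (given by nondeterministic finite automata or by morphisms into finite monoids), decide whether $(L,\mathbf{L})$ is $\mathcal{C}$-coverable. -}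

module Defs where

open import Algebra.Bundles.Raw using (RawMonoid)
open import Algebra.Morphism.Structures using (module MonoidMorphisms)
open import Algebra.Structures using (IsMonoid)
open import Data.Fin.Base using (Fin; _<_)
open import Data.Fin.Subset as Subset using (Subset; ⁅_⁆; _-_) renaming (_∪_ to _∪ˢ_; _∈_ to _∈ˢ_)
open import Data.List.Base using (List; []; _∷_; length; lookup; ++-[]-rawMonoid)
open import Data.List.Relation.Unary.All using (All)
open import Data.List.Relation.Unary.Any using (Any)
open import Data.Maybe.Base using (Maybe; just; nothing)
open import Data.Nat.Base using (ℕ)
open import Data.Product.Base using (_×_; ∃; ∃-syntax; Σ-syntax)
open import Data.Sum.Base using (_⊎_)
open import Data.Vec.Base as Vec using (Vec; _[_]≔_)
open import Function.Bundles using (_⇔_)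
open import Level using (Level; 0ℓ)
open import Relation.Binary.PropositionalEquality.Core using (_≡_)
open import Relation.Nullary.Negation.Core using (¬_)
open import Relation.Unary using (Pred; _∈_; _⊆_; _⊥_)

private
  variable
    ℓ : Level
    A : Set
    n : ℕ

Language : Set → Set₁
Language A = Pred (List A) 0ℓ

------------------------------------------------------------------------
-- First-order logic over words

-- Formulas written with the n variable names in Fin n.  Names are not
-- de Bruijn indices: a quantifier may reuse a name that is already bound
-- outside, and then shadows it.
data Formula (A : Set) (n : ℕ) : Set where
  P[_]    : A → Fin n → Formula A n
  _≺_ _≐_ : Fin n → Fin n → Formula A n
  ¬′_     : Formula A n → Formula A n
  _∧′_    : Formula A n → Formula A n → Formula A n
  _∨′_    : Formula A n → Formula A n → Formula A n
  ∃′ ∀′   : Fin n → Formula A n → Formula A n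

free : Formula A n → Subset n
free (P[ a ] x) = ⁅ x ⁆
free (x ≺ y)    = ⁅ x ⁆ ∪ˢ ⁅ y ⁆
free (x ≐ y)    = ⁅ x ⁆ ∪ˢ ⁅ y ⁆
free (¬′ φ)     = free φ
free (φ ∧′ ψ)   = free φ ∪ˢ free ψ
free (φ ∨′ ψ)   = free φ ∪ˢ free ψ
free (∃′ x φ)   = free φ - x
free (∀′ x φ)   = free φ - x

Sentence : Formula A n → Set
Sentence φ = Subset.Empty (free φ)

-- Valuations are partial because the empty word has no position to assign.
-- Atoms about unassigned names are false; this never matters for sentences.
Valuation : List A → ℕ → Set
Valuation w n = Vec (Maybe (Fin (length w))) n

infix 4 _,_⊨_ _⊨_

_,_⊨_ : (w : List A) → Valuation w n → Formula A n → Set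
w , ν ⊨ P[ a ] x = ∃[ i ] (Vec.lookup ν x ≡ just i × lookup w i ≡ a)
w , ν ⊨ x ≺ y    = ∃[ i ] ∃[ j ] (Vec.lookup ν x ≡ just i × Vec.lookup ν y ≡ just j × i < j)
w , ν ⊨ x ≐ y    = ∃[ i ] (Vec.lookup ν x ≡ just i × Vec.lookup ν y ≡ just i)
w , ν ⊨ ¬′ φ     = ¬ (w , ν ⊨ φ)
w , ν ⊨ φ ∧′ ψ   = (w , ν ⊨ φ) × (w , ν ⊨ ψ)
w , ν ⊨ φ ∨′ ψ   = (w , ν ⊨ φ) ⊎ (w , ν ⊨ ψ)
w , ν ⊨ ∃′ x φ   = ∃[ i ] (w , ν [ x ]≔ just i ⊨ φ)
w , ν ⊨ ∀′ x φ   = ∀ i → w , ν [ x ]≔ just i ⊨ φ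

_⊨_ : List A → Formula A n → Set
w ⊨ φ = w , Vec.replicate _ nothing ⊨ φ

FO[_] : ℕ → Pred (Language A) 0ℓ
FO[_] {A} n L = Σ[ φ ∈ Formula A n ] (Sentence φ × (∀ w → w ∈ L ⇔ w ⊨ φ))

FO² : Pred (Language A) 0ℓ
FO² = FO[ 2 ]

------------------------------------------------------------------------
-- Covering

-- Finite sets and finite multisets of languages are given by lists; nothing
-- below depends on order or multiplicity.

IsCover : Pred (Language A) ℓ → Language A → List (Language A) → Set _
IsCover C L Ks = All C Ks × L ⊆ (λ w → Any (w ∈_) Ks)

Separating : List (Language A) → List (Language A) → Set₁
Separating Ks Ls = All (λ K → Any (K ⊥_) Ls) Ks

Coverable : Pred (Language A) ℓ → Language A → List (Language A) → Set _
Coverable C L Ls = ∃[ Ks ] (IsCover C L Ks × Separating Ks Ls)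

------------------------------------------------------------------------
-- Presentations of regular languages

record NFA (A : Set) : Set where
  field
    states  : ℕ
    initial : Subset states
    final   : Subset states
    δ       : Fin states → A → Subset states

  AcceptsFrom : Fin states → List A → Set
  AcceptsFrom q []      = q ∈ˢ final
  AcceptsFrom q (a ∷ w) = ∃[ r ] (r ∈ˢ δ q a × AcceptsFrom r w)

  Accepts : Language A
  Accepts w = ∃[ q ] (q ∈ˢ initial × AcceptsFrom q w)

record FiniteMonoidMorphism (A : Set) : Set where
  field
    size     : ℕ
    _∙_      : Fin size → Fin size → Fin size
    ε        : Fin size
    isMonoid : IsMonoid _≡_ _∙_ ε

  rawMonoid : RawMonoid 0ℓ 0ℓ
  rawMonoid = record { Carrier = Fin size ; _≈_ = _≡_ ; _∙_ = _∙_ ; ε = ε }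

  open MonoidMorphisms (++-[]-rawMonoid A) rawMonoid using (IsMonoidHomomorphism)

  field
    ⟦_⟧       : List A → Fin size
    isHom     : IsMonoidHomomorphism ⟦_⟧
    accepting : Subset size

  Recognized : Language A
  Recognized w = ⟦ w ⟧ ∈ˢ accepting

data Presentation (A : Set) : Set where
  nfa      : NFA A → Presentation A
  morphism : FiniteMonoidMorphism A → Presentation A

language : Presentation A → Language A
language (nfa N)      = NFA.Accepts N
language (morphism α) = FiniteMonoidMorphism.Recognized α

{-# OPTIONS --safe #-}

-- Run all presentations in one automaton, the disjoint union of the given ones, and measure
-- a word by its alphabet and by the relation it induces between states.  Let the generated
-- pairs (B , x) form the least family that contains the pairs of the empty word and of the
-- letters and is closed under products and under the rule
--
--   e · s ≡ e,  t · f ≡ f  ⟹  e · star B · f is generated,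
--
-- where e, f, s, t are generated, s and t with alphabet exactly B, and star B is the relation
-- induced by all words over B.  The input is coverable iff no generated relation meets all
-- the given languages.
--
-- A generated relation that meets all of them is an obstruction: for each k, its pairs are
-- induced by words that agree on all FO² sentences of quantifier depth k.  For the rule this
-- holds because e ≡ e · sⁿ and f ≡ tⁿ · f, and because xⁿ z yⁿ and xⁿ z′ yⁿ agree up to depth
-- k < n if x and y have the same alphabet and z, z′ use no other letters.
--
-- Conversely, the words over B have an FO² cover by languages K such that e · ρ(K) · f is
-- generated, for all generated e and f.  If e and f are stable under words with alphabet
-- exactly B, the single language B* works by the rule.  Otherwise some letter a takes e to a
-- smaller right ideal (or f to a smaller left ideal); one cuts at the first (or last) a and
-- recurses on the alphabet and on the ideals.
--
-- The least family is decidable as the intersection of all closed families, of which there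
-- are finitely many.  Realizability of its members is then only known up to double negation,
-- which is enough to refute a cover.
module Submission where

open import Defs
open import Algebra.Morphism.Structures using (module MonoidMorphisms)
open import Algebra.Structures using (IsMonoid)
open import Data.Bool.Base using (true)
open import Data.Empty using (⊥)
open import Data.Fin.Base as Fin using (Fin; zero; suc; funToFin; finToFun)
open import Data.Fin.Properties as Fin using (2↔Bool; *↔×; +↔⊎)
open import Data.Fin.Subset as Subset using (Subset) renaming (_∈_ to _∈ˢ_)
import Data.Fin.Subset.Properties as Subset
open import Data.List.Base as List using (List; []; _∷_; _++_; length; map)
open import Data.List.Membership.Propositional using (find; lose) renaming (_∈_ to _∈ₗ_)
import Data.List.Membership.Propositional.Properties as List
open import Data.List.Relation.Binary.Pointwise as Listwise using ([]; _∷_)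
open import Data.List.Relation.Unary.All as All using (All; []; _∷_)
import Data.List.Relation.Unary.All.Properties as All
open import Data.List.Relation.Unary.Any as Any using (Any; here; there)
import Data.List.Relation.Unary.Any.Properties as Any
open import Data.Maybe.Base as Maybe using (Maybe; just; nothing)
open import Data.Nat.Base as ℕ using (ℕ; zero; suc; s≤s; _⊔_; _^_)
import Data.Nat.Properties as ℕ
open import Data.Product.Base using (_×_; _,_; proj₁; proj₂; ∃; ∃-syntax; Σ-syntax)
open import Data.Product.Function.NonDependent.Propositional using (_×-↔_)
open import Data.Sum.Base as Sum using (_⊎_; inj₁; inj₂; [_,_])
open import Data.Sum.Function.Propositional using (_⊎-↔_)
open import Data.Sum.Relation.Binary.Pointwise using (Pointwise; inj₁; inj₂)
open import Data.Unit.Base using (⊤; tt)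
open import Data.Vec.Base as Vec using (Vec; []; _∷_; tabulate; _[_]≔_)
import Data.Vec.Properties as Vec
open import Effect.Monad using (RawMonad)
open import Function.Base using (_∘_; id)
open import Function.Bundles using (_⇔_; mk⇔; _↔_; mk↔ₛ′; Inverse; Equivalence)
open import Function.Construct.Composition using (_↔-∘_)
open import Function.Construct.Symmetry using (↔-sym)
import Function.Properties.Equivalence as ⇔
open import Relation.Binary.Definitions using (DecidableEquality; tri<; tri≈; tri>)
open import Relation.Binary.PropositionalEquality hiding ([_])
open import Relation.Nullary.Decidable
  using (Dec; yes; no; does; dec-true; map′; decidable-stable; ¬¬-excluded-middle;
         ¬?; _×-dec_; _⊎-dec_; _→-dec_)
open import Relation.Nullary.Negation using (¬_; contradiction; ¬¬-map; ¬¬-Monad)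
open import Relation.Unary using (Decidable) renaming (_∈_ to _∈ᴸ_; _⊥_ to _⊥ᴸ_)

-- Finite types

record Finite (X : Set) : Set where
  field
    {size} : ℕ
    code   : X ↔ Fin size

  open Inverse code public using () renaming (to to index; from to element)

  element-index : ∀ x → element (index x) ≡ x
  element-index = Inverse.strictlyInverseʳ code

  index-element : ∀ i → index (element i) ≡ i
  index-element = Inverse.strictlyInverseˡ code

private
  variable
    X Y : Set

module _ ⦃ F : Finite X ⦄ where

  open Finite F using (index; element; element-index)

  exists? : ∀ {ℓ} {P : X → Set ℓ} → Decidable P → Dec (∃ P)
  exists? {P = P} P? = map′
    (λ (i , p) → element i , p)
    (λ (x , p) → index x , subst P (sym (element-index x)) p)
    (Fin.any? (P? ∘ element))

  forall? : {P : X → Set} → Decidable P → Dec (∀ x → P x)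
  forall? {P} P? = map′
    (λ p x → subst P (element-index x) (p (index x)))
    (λ p i → p (element i))
    (Fin.all? (P? ∘ element))

  infix 4 _≟_

  _≟_ : DecidableEquality X
  x ≟ y = map′
    (λ eq → trans (sym (element-index x)) (trans (cong element eq) (element-index y)))
    (cong index)
    (index x Fin.≟ index y)

  -- Over a finite type only finitely many instances of excluded middle are needed, and these hold
  -- together under one double negation. This serves refutations that involve predicates not yet
  -- known to be decidable.
  ¬¬-decidable : (P : X → Set) → ¬ ¬ Decidable P
  ¬¬-decidable P = ¬¬-map
    (λ P? x → subst (Dec ∘ P) (element-index x) (P? (index x)))
    (Fin.sequence (RawMonad.rawApplicative ¬¬-Monad) {P = Dec ∘ P ∘ element}
      (λ _ → ¬¬-excluded-middle))

-- The wrapper keeps `X` in the type; a bare `Subset` records only the number of elements.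
record Sub (X : Set) ⦃ F : Finite X ⦄ : Set where
  constructor sub
  field
    bits : Subset (Finite.size F)

open Sub using (bits)

module _ ⦃ F : Finite X ⦄ where

  open Finite F using (index; element; element-index; index-element)

  infix 4 _∈_ _∈?_

  opaque
    _∈_ : X → Sub X → Set
    x ∈ S = index x ∈ˢ bits S

    _∈?_ : ∀ x S → Dec (x ∈ S)
    x ∈? S = index x Subset.∈? bits S

    ⟪_⟫ : {P : X → Set} → Decidable P → Sub X
    ⟪ P? ⟫ = sub (tabulate (does ∘ P? ∘ element))

    ∈⟪⟫⁺ : {P : X → Set} (P? : Decidable P) → ∀ {x} → P x → x ∈ ⟪ P? ⟫
    ∈⟪⟫⁺ {P} P? {x} p = Vec.lookup⇒[]= (index x) _ (trans (Vec.lookup∘tabulate _ (index x)) eq)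
      where
      eq : does (P? (element (index x))) ≡ true
      eq = dec-true (P? _) (subst P (sym (element-index x)) p)

    ∈⟪⟫⁻ : {P : X → Set} (P? : Decidable P) → ∀ {x} → x ∈ ⟪ P? ⟫ → P x
    ∈⟪⟫⁻ {P} P? {x} x∈ = subst P (element-index x) (witness (P? _) eq)
      where
      witness : ∀ {Z : Set} (Z? : Dec Z) → does Z? ≡ true → Z
      witness (yes z) _ = z
      eq : does (P? (element (index x))) ≡ true
      eq = trans (sym (Vec.lookup∘tabulate _ (index x))) (Vec.[]=⇒lookup x∈)

    ∣_∣ : Sub X → ℕ
    ∣ S ∣ = Subset.∣ bits S ∣

    ⊆⇒⊆ˢ : ∀ {S T : Sub X} → (∀ x → x ∈ S → x ∈ T) → bits S Subset.⊆ bits T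
    ⊆⇒⊆ˢ {S} {T} S⊆T {i} i∈S = subst (_∈ˢ bits T) (index-element i)
      (S⊆T (element i) (subst (_∈ˢ bits S) (sym (index-element i)) i∈S))

    ⊆-antisym : ∀ {S T : Sub X} → (∀ x → x ∈ S → x ∈ T) → (∀ x → x ∈ T → x ∈ S) → S ≡ T
    ⊆-antisym S⊆T T⊆S = cong sub (Subset.⊆-antisym (⊆⇒⊆ˢ S⊆T) (⊆⇒⊆ˢ T⊆S))

    ⊂⇒∣∣< : ∀ {S T : Sub X} → (∀ x → x ∈ S → x ∈ T) → ∀ x → x ∈ T → ¬ x ∈ S →
            ∣ S ∣ ℕ.< ∣ T ∣
    ⊂⇒∣∣< S⊆T x x∈T x∉S = Subset.p⊂q⇒∣p∣<∣q∣ (⊆⇒⊆ˢ S⊆T , index x , x∈T , x∉S)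

instance
  finite-Fin : ∀ {n} → Finite (Fin n)
  finite-Fin = record { code = mk↔ₛ′ id id (λ _ → refl) (λ _ → refl) }

  finite-× : ⦃ Finite X ⦄ → ⦃ Finite Y ⦄ → Finite (X × Y)
  finite-× ⦃ F ⦄ ⦃ G ⦄ =
    record { code = ↔-sym *↔× ↔-∘ (Finite.code F ×-↔ Finite.code G) }

  finite-⊎ : ⦃ Finite X ⦄ → ⦃ Finite Y ⦄ → Finite (X ⊎ Y)
  finite-⊎ ⦃ F ⦄ ⦃ G ⦄ =
    record { code = ↔-sym +↔⊎ ↔-∘ (Finite.code F ⊎-↔ Finite.code G) }

  finite-Sub : ⦃ F : Finite X ⦄ → Finite (Sub X)
  finite-Sub ⦃ F ⦄ = record { code = mk↔ₛ′ encode decode encode-decode decode-encode }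
    where
    open Inverse 2↔Bool using (to; from; strictlyInverseˡ; strictlyInverseʳ)

    n = Finite.size F

    encode : Sub _ → Fin (2 ^ n)
    encode (sub S) = funToFin (from ∘ Vec.lookup S)

    decode : Fin (2 ^ n) → Sub _
    decode i = sub (tabulate (to ∘ finToFun i))

    funToFin-cong : ∀ {m} (f g : Fin m → Fin 2) → (∀ i → f i ≡ g i) → funToFin f ≡ funToFin g
    funToFin-cong {zero}  f g f≗g = refl
    funToFin-cong {suc m} f g f≗g =
      cong₂ Fin.combine (f≗g zero) (funToFin-cong (f ∘ suc) (g ∘ suc) (f≗g ∘ suc))

    encode-decode : ∀ i → encode (decode i) ≡ i
    encode-decode i = trans
      (funToFin-cong (from ∘ Vec.lookup (bits (decode i))) (finToFun {2} {n} i)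
        (λ j → trans (cong from (Vec.lookup∘tabulate (to ∘ finToFun i) j)) (strictlyInverseʳ _)))
      (Fin.funToFin-finToFin {n} i)

    decode-encode : ∀ S → decode (encode S) ≡ S
    decode-encode (sub S) = cong sub (trans
      (Vec.tabulate-cong (λ j → trans
        (cong to (Fin.finToFun-funToFin (from ∘ Vec.lookup S) j)) (strictlyInverseˡ _)))
      (Vec.tabulate∘lookup S))

-- Back-and-forth games

private
  variable
    A : Set

data Side : Set where
  left right : Side

record Structure (A : Set) : Set₁ where
  infix 4 _<_
  field
    Pos   : Set
    label : Pos → A
    _<_   : Pos → Pos → Set

  Beside : Side → Pos → Pos → Set
  Beside left  i j = j < i
  Beside right i j = i < j

open Structure using (Pos; label; Beside)

word : List A → Structure A
word w = record { Pos = Fin (length w) ; label = List.lookup w ; _<_ = Fin._<_ }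

infixr 5 _⊕_

_⊕_ : Structure A → Structure A → Structure A
S ⊕ T = record { Pos = Pos S ⊎ Pos T ; label = [ label S , label T ] ; _<_ = _<⊕_ }
  where
  open Structure using (_<_)
  _<⊕_ : Pos S ⊎ Pos T → Pos S ⊎ Pos T → Set
  inj₁ i <⊕ inj₁ j = _<_ S i j
  inj₁ i <⊕ inj₂ j = ⊤
  inj₂ i <⊕ inj₁ j = ⊥
  inj₂ i <⊕ inj₂ j = _<_ T i j

Forth : (S T : Structure A) → (Pos S → Pos T → Set) → Pos S → Pos T → Set
Forth S T R i i′ = ∀ d j → Beside S d i j → ∃[ j′ ] (Beside T d i′ j′ × R j j′)

-- The two-pebble game in which only one pebble position is compared: the
-- relative order of the pebbles is preserved by each move.
Sim : ℕ → (S T : Structure A) → Pos S → Pos T → Set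
Sim zero    S T i i′ = label S i ≡ label T i′
Sim (suc k) S T i i′ =
  Sim k S T i i′ × Forth S T (Sim k S T) i i′ × Forth T S (λ j′ j → Sim k S T j j′) i′ i

Total : (S T : Structure A) → (Pos S → Pos T → Set) → Set
Total S T R = ∀ i → ∃[ i′ ] R i i′

infix 4 _≈[_]_

-- The game before any pebble is placed: an unrestricted opening move, followed by k further moves.
-- At level 0 it compares the sets of letters.
record _≈[_]_ (S : Structure A) (k : ℕ) (T : Structure A) : Set where
  field
    forth : Total S T (Sim k S T)
    back  : Total T S (λ i′ i → Sim k S T i i′)

open _≈[_]_

sim-label : ∀ k (S T : Structure A) {i i′} → Sim k S T i i′ → label S i ≡ label T i′
sim-label zero    S T eq      = eq
sim-label (suc k) S T (s , _) = sim-label k S T s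

sim-sym : ∀ k (S T : Structure A) {i i′} → Sim k S T i i′ → Sim k T S i′ i
sim-sym zero    S T eq = sym eq
sim-sym (suc k) S T (s , forth , back) =
    sim-sym k S T s
  , (λ d j b → let (j′ , b′ , s′) = back d j b in j′ , b′ , sim-sym k S T s′)
  , (λ d j b → let (j′ , b′ , s′) = forth d j b in j′ , b′ , sim-sym k S T s′)

sim-trans : ∀ k (S T U : Structure A) {h i j} → Sim k S T h i → Sim k T U i j → Sim k S U h j
sim-trans zero    S T U p q = trans p q
sim-trans (suc k) S T U (s , forth , back) (s′ , forth′ , back′) =
    sim-trans k S T U s s′
  , (λ d j b →
      let (j₁ , b₁ , s₁) = forth d j b
          (j₂ , b₂ , s₂) = forth′ d j₁ b₁
      in j₂ , b₂ , sim-trans k S T U s₁ s₂)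
  , (λ d j b →
      let (j₁ , b₁ , s₁) = back′ d j b
          (j₂ , b₂ , s₂) = back d j₁ b₁
      in j₂ , b₂ , sim-trans k S T U s₂ s₁)

≈-refl : ∀ {k} {S : Structure A} → S ≈[ k ] S
≈-refl {k = k} {S} = record { forth = λ i → i , sim-refl k i ; back = λ i → i , sim-refl k i }
  where
  sim-refl : ∀ k i → Sim k S S i i
  sim-refl zero    i = refl
  sim-refl (suc k) i =
    sim-refl k i , (λ d j b → j , b , sim-refl k j) , (λ d j b → j , b , sim-refl k j)

≈-sym : ∀ {k} {S T : Structure A} → S ≈[ k ] T → T ≈[ k ] S
≈-sym {k = k} {S} {T} e = record
  { forth = λ i → let (i′ , s) = back e i in i′ , sim-sym k S T s
  ; back  = λ i → let (i′ , s) = forth e i in i′ , sim-sym k S T s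
  }

≈-trans : ∀ {k} {S T U : Structure A} → S ≈[ k ] T → T ≈[ k ] U → S ≈[ k ] U
≈-trans {k = k} {S} {T} {U} e f = record
  { forth = λ i →
      let (i₁ , s₁) = forth e i ; (i₂ , s₂) = forth f i₁ in i₂ , sim-trans k S T U s₁ s₂
  ; back = λ i →
      let (i₁ , s₁) = back f i ; (i₂ , s₂) = back e i₁ in i₂ , sim-trans k S T U s₂ s₁
  }

≈-pred : ∀ {k} {S T : Structure A} → S ≈[ suc k ] T → S ≈[ k ] T
≈-pred e = record
  { forth = λ i → let (i′ , s) = forth e i in i′ , proj₁ s
  ; back  = λ i → let (i′ , s) = back e i in i′ , proj₁ s
  }

≈-mono : ∀ {k l} {S T : Structure A} → k ℕ.≤′ l → S ≈[ l ] T → S ≈[ k ] T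
≈-mono ℕ.≤′-refl       e = e
≈-mono (ℕ.≤′-step k≤l) e = ≈-mono k≤l (≈-pred e)

⊎-map : ∀ {I I′ J J′ : Set} {P P′ : I → I′ → Set} {Q Q′ : J → J′ → Set} →
        (∀ {i i′} → P i i′ → P′ i i′) → (∀ {j j′} → Q j j′ → Q′ j j′) →
        ∀ {x x′} → Pointwise P Q x x′ → Pointwise P′ Q′ x x′
⊎-map f g (inj₁ p) = inj₁ (f p)
⊎-map f g (inj₂ q) = inj₂ (g q)

⊎-flip : ∀ {I I′ J J′ : Set} {P : I → I′ → Set} {P′ : I′ → I → Set}
         {Q : J → J′ → Set} {Q′ : J′ → J → Set} →
         (∀ {i i′} → P i i′ → P′ i′ i) → (∀ {j j′} → Q j j′ → Q′ j′ j) →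
         ∀ {x x′} → Pointwise P Q x x′ → Pointwise P′ Q′ x′ x
⊎-flip f g (inj₁ p) = inj₁ (f p)
⊎-flip f g (inj₂ q) = inj₂ (g q)

-- A move inside the current summand is answered by the game there. A move into the other summand is
-- answered by an opening move of that summand, since all its positions lie on the same side.
⊕-forth : ∀ k {S S′ T T′ : Structure A} → S ≈[ k ] S′ → T ≈[ k ] T′ → ∀ {x x′} →
          Pointwise (Sim (suc k) S S′) (Sim (suc k) T T′) x x′ →
          Forth (S ⊕ T) (S′ ⊕ T′) (Pointwise (Sim k S S′) (Sim k T T′)) x x′
⊕-forth k e f (inj₁ (_ , forth , _)) left (inj₁ j) b =
  let (j′ , b′ , s′) = forth left j b in inj₁ j′ , b′ , inj₁ s′
⊕-forth k e f (inj₁ (_ , forth , _)) right (inj₁ j) b =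
  let (j′ , b′ , s′) = forth right j b in inj₁ j′ , b′ , inj₁ s′
⊕-forth k e f (inj₁ _) right (inj₂ j) _ =
  let (j′ , s′) = forth f j in inj₂ j′ , tt , inj₂ s′
⊕-forth k e f (inj₂ _) left (inj₁ j) _ =
  let (j′ , s′) = forth e j in inj₁ j′ , tt , inj₁ s′
⊕-forth k e f (inj₂ (_ , forth , _)) left (inj₂ j) b =
  let (j′ , b′ , s′) = forth left j b in inj₂ j′ , b′ , inj₂ s′
⊕-forth k e f (inj₂ (_ , forth , _)) right (inj₂ j) b =
  let (j′ , b′ , s′) = forth right j b in inj₂ j′ , b′ , inj₂ s′

⊕-sim : ∀ k {S S′ T T′ : Structure A} → S ≈[ k ] S′ → T ≈[ k ] T′ → ∀ {x x′} →
        Pointwise (Sim k S S′) (Sim k T T′) x x′ → Sim k (S ⊕ T) (S′ ⊕ T′) x x′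
⊕-sim zero e f (inj₁ eq) = eq
⊕-sim zero e f (inj₂ eq) = eq
⊕-sim (suc k) {S} {S′} {T} {T′} e f {x} {x′} s =
    ⊕-sim k e↓ f↓ (⊎-map proj₁ proj₁ s)
  , (λ d j b →
      let (j′ , b′ , s′) = ⊕-forth k e↓ f↓ s d j b
      in j′ , b′ , ⊕-sim k e↓ f↓ s′)
  , (λ d j b →
      let (j′ , b′ , s′) = ⊕-forth k (≈-sym e↓) (≈-sym f↓) flipped d j b
      in j′ , b′ , ⊕-sim k e↓ f↓ (⊎-flip (sim-sym k S′ S) (sim-sym k T′ T) s′))
  where
  e↓ = ≈-pred e
  f↓ = ≈-pred f
  flipped : Pointwise (Sim (suc k) S′ S) (Sim (suc k) T′ T) x′ x
  flipped = ⊎-flip (sim-sym (suc k) S S′) (sim-sym (suc k) T T′) s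

⊕-cong : ∀ {k} {S S′ T T′ : Structure A} → S ≈[ k ] S′ → T ≈[ k ] T′ → S ⊕ T ≈[ k ] S′ ⊕ T′
⊕-cong {k = k} e f = record
  { forth = λ where
      (inj₁ i) → let (i′ , s) = forth e i in inj₁ i′ , ⊕-sim k e f (inj₁ s)
      (inj₂ i) → let (i′ , s) = forth f i in inj₂ i′ , ⊕-sim k e f (inj₂ s)
  ; back = λ where
      (inj₁ i) → let (i′ , s) = back e i in inj₁ i′ , ⊕-sim k e f (inj₁ s)
      (inj₂ i) → let (i′ , s) = back f i in inj₂ i′ , ⊕-sim k e f (inj₂ s)
  }

-- Concatenation of words as an ordered sum

join : (u v : List A) → Pos (word u ⊕ word v) → Pos (word (u ++ v))
join []      v (inj₂ j)       = j
join (a ∷ u) v (inj₁ zero)    = zero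
join (a ∷ u) v (inj₁ (suc i)) = suc (join u v (inj₁ i))
join (a ∷ u) v (inj₂ j)       = suc (join u v (inj₂ j))

split : (u v : List A) → Pos (word (u ++ v)) → Pos (word u ⊕ word v)
split []      v j       = inj₂ j
split (a ∷ u) v zero    = inj₁ zero
split (a ∷ u) v (suc i) = Sum.map₁ suc (split u v i)

join-split : (u v : List A) → ∀ i → join u v (split u v i) ≡ i
join-split []      v j    = refl
join-split (a ∷ u) v zero = refl
join-split (a ∷ u) v (suc i) with split u v i | join-split u v i
... | inj₁ _ | eq = cong suc eq
... | inj₂ _ | eq = cong suc eq

join-label : (u v : List A) → ∀ x → label (word u ⊕ word v) x ≡ label (word (u ++ v)) (join u v x)
join-label []      v (inj₂ j)       = refl
join-label (a ∷ u) v (inj₁ zero)    = refl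
join-label (a ∷ u) v (inj₁ (suc i)) = join-label u v (inj₁ i)
join-label (a ∷ u) v (inj₂ j)       = join-label u v (inj₂ j)

join-mono : (u v : List A) → ∀ x y → Structure._<_ (word u ⊕ word v) x y →
            join u v x Fin.< join u v y
join-mono []      v (inj₂ i)       (inj₂ j)       i<j       = i<j
join-mono (a ∷ u) v (inj₁ zero)    (inj₁ (suc j)) _         = ℕ.z<s
join-mono (a ∷ u) v (inj₁ (suc i)) (inj₁ (suc j)) (s≤s i<j) =
  s≤s (join-mono u v (inj₁ i) (inj₁ j) i<j)
join-mono (a ∷ u) v (inj₁ zero)    (inj₂ j)       _         = ℕ.z<s
join-mono (a ∷ u) v (inj₁ (suc i)) (inj₂ j)       _ =
  s≤s (join-mono u v (inj₁ i) (inj₂ j) tt)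
join-mono (a ∷ u) v (inj₂ i)       (inj₂ j)       i<j =
  s≤s (join-mono u v (inj₂ i) (inj₂ j) i<j)

join-cancel-< : (u v : List A) → ∀ x y → join u v x Fin.< join u v y →
                Structure._<_ (word u ⊕ word v) x y
join-cancel-< []      v (inj₂ i)       (inj₂ j)       i<j       = i<j
join-cancel-< (a ∷ u) v (inj₁ zero)    (inj₁ (suc j)) _         = ℕ.z<s
join-cancel-< (a ∷ u) v (inj₁ (suc i)) (inj₁ (suc j)) (s≤s i<j) =
  s≤s (join-cancel-< u v (inj₁ i) (inj₁ j) i<j)
join-cancel-< (a ∷ u) v (inj₁ _)       (inj₂ j)       _         = tt
join-cancel-< (a ∷ u) v (inj₂ i)       (inj₁ (suc j)) (s≤s i<j) =
  join-cancel-< u v (inj₂ i) (inj₁ j) i<j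
join-cancel-< (a ∷ u) v (inj₂ i)       (inj₂ j)       (s≤s i<j) =
  join-cancel-< u v (inj₂ i) (inj₂ j) i<j

-- An isomorphism of labelled orders wins the game at every level: each move is answered by its
-- image or preimage.
join-sim : ∀ k (u v : List A) x → Sim k (word u ⊕ word v) (word (u ++ v)) x (join u v x)
join-sim zero    u v x = join-label u v x
join-sim (suc k) u v x =
    join-sim k u v x
  , (λ where
      left  y y<x → join u v y , join-mono u v y x y<x , join-sim k u v y
      right y x<y → join u v y , join-mono u v x y x<y , join-sim k u v y)
  , (λ where
      left  j j<x → split u v j
        , join-cancel-< u v (split u v j) x (subst (Fin._< join u v x) (sym (join-split u v j)) j<x)
        , at j
      right j x<j → split u v j
        , join-cancel-< u v x (split u v j) (subst (join u v x Fin.<_) (sym (join-split u v j)) x<j)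
        , at j)
  where
  at : ∀ j → Sim k (word u ⊕ word v) (word (u ++ v)) (split u v j) j
  at j = subst (Sim k _ _ (split u v j)) (join-split u v j) (join-sim k u v (split u v j))

word-++ : ∀ {k} (u v : List A) → word (u ++ v) ≈[ k ] word u ⊕ word v
word-++ {k = k} u v = ≈-sym record
  { forth = λ x → join u v x , join-sim k u v x
  ; back  = λ j → split u v j
      , subst (Sim k _ _ (split u v j)) (join-split u v j) (join-sim k u v (split u v j))
  }

infix 4 _∼[_]_

-- Unlike word u ≈[ k ] word v, this type determines u and v.
record _∼[_]_ (u : List A) (k : ℕ) (v : List A) : Set where
  constructor equivalent
  field
    words : word u ≈[ k ] word v

∼-trans : ∀ {k} {u v w : List A} → u ∼[ k ] v → v ∼[ k ] w → u ∼[ k ] w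
∼-trans (equivalent e) (equivalent f) = equivalent (≈-trans e f)

∼-sym : ∀ {k} {u v : List A} → u ∼[ k ] v → v ∼[ k ] u
∼-sym (equivalent e) = equivalent (≈-sym e)

∼-refl : ∀ {k} {u : List A} → u ∼[ k ] u
∼-refl = equivalent ≈-refl

∼-mono : ∀ {k l} {u v : List A} → k ℕ.≤ l → u ∼[ l ] v → u ∼[ k ] v
∼-mono k≤l (equivalent e) = equivalent (≈-mono (ℕ.≤⇒≤′ k≤l) e)

++-cong : ∀ {k} {u u′ v v′ : List A} → u ∼[ k ] u′ → v ∼[ k ] v′ → u ++ v ∼[ k ] u′ ++ v′
++-cong {u = u} {u′} {v} {v′} (equivalent e) (equivalent f) = equivalent
  (≈-trans (word-++ u v) (≈-trans (⊕-cong e f) (≈-sym (word-++ u′ v′))))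

++-cong-inner : ∀ {k} (u v : List A) {x y : List A} → x ∼[ k ] y →
                u ++ (x ++ v) ∼[ k ] u ++ (y ++ v)
++-cong-inner u v e = ++-cong {u = u} ∼-refl (++-cong e (∼-refl {u = v}))

-- Words of the form x^n z y^n, layered from the outside in

nest : ℕ → (x y z : List A) → List A
nest zero    x y z = z
nest (suc n) x y z = x ++ (nest n x y z ++ y)

infix 4 _⊑_

_⊑_ : Structure A → Structure A → Set
S ⊑ T = ∀ i → ∃[ j ] (label S i ≡ label T j)

module _ {A : Set} (X Y : Structure A) where

  Nest : ℕ → Structure A → Structure A
  Nest zero    Z = Z
  Nest (suc n) Z = X ⊕ (Nest n Z ⊕ Y)

  pattern outerˡ p = inj₁ p
  pattern nested i  = inj₂ (inj₁ i)
  pattern outerʳ p = inj₂ (inj₂ p)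

  -- The invariant of the game on Nest n Z and Nest n Z′ with k moves left:
  -- positions in one of the k outermost layers agree, deeper ones only need
  -- to have the same label.
  Inv : (n k : ℕ) (Z Z′ : Structure A) → Pos (Nest n Z) → Pos (Nest n Z′) → Set
  Inv n       zero    Z Z′ i          i′          = label (Nest n Z) i ≡ label (Nest n Z′) i′
  Inv (suc n) (suc k) Z Z′ (outerˡ p) (outerˡ p′) = p ≡ p′
  Inv (suc n) (suc k) Z Z′ (nested i)  (nested i′)  = Inv n k Z Z′ i i′
  Inv (suc n) (suc k) Z Z′ (outerʳ p) (outerʳ p′) = p ≡ p′
  Inv _       _       Z Z′ _          _           = ⊥

  inv-pred : ∀ n k {Z Z′} i i′ → Inv n (suc k) Z Z′ i i′ → Inv n k Z Z′ i i′
  inv-pred (suc n) zero    (outerˡ p) (outerˡ _)  refl = refl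
  inv-pred (suc n) zero    (nested i)  (nested i′)  eq   = eq
  inv-pred (suc n) zero    (outerʳ p) (outerʳ _)  refl = refl
  inv-pred (suc n) (suc k) (outerˡ p) (outerˡ _)  refl = refl
  inv-pred (suc n) (suc k) (nested i)  (nested i′)  r    = inv-pred n k i i′ r
  inv-pred (suc n) (suc k) (outerʳ p) (outerʳ _)  refl = refl

  inv-sym : ∀ n k {Z Z′} i i′ → Inv n k Z Z′ i i′ → Inv n k Z′ Z i′ i
  inv-sym n       zero    i          i′          eq   = sym eq
  inv-sym (suc n) (suc k) (outerˡ p) (outerˡ _)  refl = refl
  inv-sym (suc n) (suc k) (nested i)  (nested i′)  r    = inv-sym n k i i′ r
  inv-sym (suc n) (suc k) (outerʳ p) (outerʳ _)  refl = refl

  module _ (X⊑Y : X ⊑ Y) (Y⊑X : Y ⊑ X) where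

    nest-⊑ˡ : ∀ n {Z} → Z ⊑ X → Nest n Z ⊑ X
    nest-⊑ˡ zero    Z⊑X i          = Z⊑X i
    nest-⊑ˡ (suc n) Z⊑X (outerˡ p) = p , refl
    nest-⊑ˡ (suc n) Z⊑X (nested i)  = nest-⊑ˡ n Z⊑X i
    nest-⊑ˡ (suc n) Z⊑X (outerʳ p) = Y⊑X p

    nest-⊑ʳ : ∀ n {Z} → Z ⊑ X → Nest n Z ⊑ Y
    nest-⊑ʳ n Z⊑X i =
      let (p , eq) = nest-⊑ˡ n Z⊑X i ; (q , eq′) = X⊑Y p in q , trans eq eq′

    -- The k outer layers are copied. Below them only a label is asked for, and k < n leaves one
    -- more copy of `X` to supply it.
    inv-total : ∀ n k {Z Z′} → Z ⊑ X → k ℕ.< n → Total (Nest n Z) (Nest n Z′) (Inv n k Z Z′)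
    inv-total (suc n) zero    Z⊑X k<n i =
      let (p , eq) = nest-⊑ˡ (suc n) Z⊑X i in outerˡ p , eq
    inv-total (suc n) (suc k) Z⊑X k<n (outerˡ p) = outerˡ p , refl
    inv-total (suc n) (suc k) Z⊑X (s≤s k<n) (nested i) =
      let (i′ , r) = inv-total n k Z⊑X k<n i in nested i′ , r
    inv-total (suc n) (suc k) Z⊑X k<n (outerʳ p) = outerʳ p , refl

    inv-outerˡ : ∀ n k {Z Z′} p → Inv (suc n) k Z Z′ (outerˡ p) (outerˡ p)
    inv-outerˡ n zero    p = refl
    inv-outerˡ n (suc k) p = refl

    inv-outerʳ : ∀ n k {Z Z′} p → Inv (suc n) k Z Z′ (outerʳ p) (outerʳ p)
    inv-outerʳ n zero    p = refl
    inv-outerʳ n (suc k) p = refl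

    -- Moves to the outermost layer are copied. A move into the nested part is passed on to the
    -- inner nest as long as moves remain; with none left only the label counts, and it is found in
    -- the outermost `X` for a move to the left and in the outermost `Y` for a move to the right.
    -- This is where both sides must carry all the letters.
    inv-forth : ∀ n k {Z Z′} → Z ⊑ X → suc k ℕ.< n → ∀ i i′ → Inv n (suc k) Z Z′ i i′ →
                Forth (Nest n Z) (Nest n Z′) (Inv n k Z Z′) i i′
    inv-forth (suc n) k Z⊑X _ (outerˡ _) (outerˡ _) refl left  (outerˡ q) b =
      outerˡ q , b , inv-outerˡ n k q
    inv-forth (suc n) k Z⊑X _ (outerˡ _) (outerˡ _) refl right (outerˡ q) b =
      outerˡ q , b , inv-outerˡ n k q
    inv-forth (suc n) k Z⊑X _ (outerˡ _) (outerˡ _) refl right (outerʳ q) b =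
      outerʳ q , tt , inv-outerʳ n k q
    inv-forth (suc n) k Z⊑X _ (nested _)  (nested _)  _    left  (outerˡ q) b =
      outerˡ q , tt , inv-outerˡ n k q
    inv-forth (suc n) k Z⊑X _ (nested _)  (nested _)  _    right (outerʳ q) b =
      outerʳ q , tt , inv-outerʳ n k q
    inv-forth (suc n) k Z⊑X _ (outerʳ _) (outerʳ _) refl left  (outerˡ q) b =
      outerˡ q , tt , inv-outerˡ n k q
    inv-forth (suc n) k Z⊑X _ (outerʳ _) (outerʳ _) refl left  (outerʳ q) b =
      outerʳ q , b , inv-outerʳ n k q
    inv-forth (suc n) k Z⊑X _ (outerʳ _) (outerʳ _) refl right (outerʳ q) b =
      outerʳ q , b , inv-outerʳ n k q
    inv-forth (suc n) zero Z⊑X _ (outerˡ _) (outerˡ _) _ right (nested j) b =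
      let (q , eq) = nest-⊑ʳ n Z⊑X j in outerʳ q , tt , eq
    inv-forth (suc n) zero Z⊑X _ (nested _)  (nested _)  _ left  (nested j) b =
      let (q , eq) = nest-⊑ˡ n Z⊑X j in outerˡ q , tt , eq
    inv-forth (suc n) zero Z⊑X _ (nested _)  (nested _)  _ right (nested j) b =
      let (q , eq) = nest-⊑ʳ n Z⊑X j in outerʳ q , tt , eq
    inv-forth (suc n) zero Z⊑X _ (outerʳ _) (outerʳ _) _ left  (nested j) b =
      let (q , eq) = nest-⊑ˡ n Z⊑X j in outerˡ q , tt , eq
    inv-forth (suc n) (suc k) Z⊑X (s≤s k<n) (outerˡ _) (outerˡ _) _ right (nested j) b =
      let (j′ , r) = inv-total n k Z⊑X (ℕ.<⇒≤ k<n) j in nested j′ , tt , r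
    inv-forth (suc n) (suc k) Z⊑X (s≤s k<n) (nested i)  (nested i′) r left  (nested j) b =
      let (j′ , b′ , r′) = inv-forth n k Z⊑X k<n i i′ r left j b in nested j′ , b′ , r′
    inv-forth (suc n) (suc k) Z⊑X (s≤s k<n) (nested i)  (nested i′) r right (nested j) b =
      let (j′ , b′ , r′) = inv-forth n k Z⊑X k<n i i′ r right j b in nested j′ , b′ , r′
    inv-forth (suc n) (suc k) Z⊑X (s≤s k<n) (outerʳ _) (outerʳ _) _ left  (nested j) b =
      let (j′ , r) = inv-total n k Z⊑X (ℕ.<⇒≤ k<n) j in nested j′ , tt , r

    inv-sim : ∀ n k {Z Z′} → Z ⊑ X → Z′ ⊑ X → k ℕ.< n → ∀ i i′ → Inv n k Z Z′ i i′ →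
              Sim k (Nest n Z) (Nest n Z′) i i′
    inv-sim n zero    Z⊑X Z′⊑X k<n i i′ eq = eq
    inv-sim n (suc k) Z⊑X Z′⊑X k<n i i′ r =
        inv-sim n k Z⊑X Z′⊑X k<n↓ i i′ (inv-pred n k i i′ r)
      , (λ d j b →
          let (j′ , b′ , r′) = inv-forth n k Z⊑X k<n i i′ r d j b
          in j′ , b′ , inv-sim n k Z⊑X Z′⊑X k<n↓ j j′ r′)
      , (λ d j b →
          let (j′ , b′ , r′) = inv-forth n k Z′⊑X k<n i′ i (inv-sym n (suc k) i i′ r) d j b
          in j′ , b′ , inv-sim n k Z⊑X Z′⊑X k<n↓ j′ j (inv-sym n k j j′ r′))
      where
      k<n↓ = ℕ.<⇒≤ k<n

    nest-≈ : ∀ n k {Z Z′} → Z ⊑ X → Z′ ⊑ X → k ℕ.< n → Nest n Z ≈[ k ] Nest n Z′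
    nest-≈ n k Z⊑X Z′⊑X k<n = record
      { forth = λ i →
          let (i′ , r) = inv-total n k Z⊑X k<n i
          in i′ , inv-sim n k Z⊑X Z′⊑X k<n i i′ r
      ; back = λ i →
          let (i′ , r) = inv-total n k Z′⊑X k<n i
          in i′ , inv-sim n k Z⊑X Z′⊑X k<n i′ i (inv-sym n k i i′ r)
      }

word-nest : ∀ {k} n (x y z : List A) →
            word (nest n x y z) ≈[ k ] Nest (word x) (word y) n (word z)
word-nest zero    x y z = ≈-refl
word-nest (suc n) x y z = ≈-trans
  (word-++ x (nest n x y z ++ y))
  (⊕-cong ≈-refl (≈-trans (word-++ (nest n x y z) y) (⊕-cong (word-nest n x y z) ≈-refl)))

nest-cong : ∀ n k (x y z z′ : List A) → word x ⊑ word y → word y ⊑ word x →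
            word z ⊑ word x → word z′ ⊑ word x → k ℕ.< n →
            nest n x y z ∼[ k ] nest n x y z′
nest-cong n k x y z z′ x⊑y y⊑x z⊑x z′⊑x k<n =
  equivalent (≈-trans (word-nest n x y z)
    (≈-trans (nest-≈ (word x) (word y) x⊑y y⊑x n k z⊑x z′⊑x k<n)
      (≈-sym (word-nest n x y z′))))

-- Equivalent words satisfy the same two-variable formulas

depth : ∀ {n} → Formula A n → ℕ
depth (P[ a ] x) = 0
depth (x ≺ y)    = 0
depth (x ≐ y)    = 0
depth (¬′ φ)     = depth φ
depth (φ ∧′ ψ)   = depth φ ⊔ depth ψ
depth (φ ∨′ ψ)   = depth φ ⊔ depth ψ
depth (∃′ x φ)   = suc (depth φ)
depth (∀′ x φ)   = suc (depth φ)

data SameOrder {m n} (i j : Fin m) (i′ j′ : Fin n) : Set where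
  less    : i Fin.< j → i′ Fin.< j′ → SameOrder i j i′ j′
  equal   : i ≡ j → i′ ≡ j′ → SameOrder i j i′ j′
  greater : j Fin.< i → j′ Fin.< i′ → SameOrder i j i′ j′

sameOrder-flip : ∀ {m n} {i j : Fin m} {i′ j′ : Fin n} → SameOrder i j i′ j′ → SameOrder j i j′ i′
sameOrder-flip (less p q)    = greater p q
sameOrder-flip (equal p q)   = equal (sym p) (sym q)
sameOrder-flip (greater p q) = less p q

sameOrder-sym : ∀ {m n} {i j : Fin m} {i′ j′ : Fin n} → SameOrder i j i′ j′ → SameOrder i′ j′ i j
sameOrder-sym (less p q)    = less q p
sameOrder-sym (equal p q)   = equal q p
sameOrder-sym (greater p q) = greater q p

sameOrder-< : ∀ {m n} {i j : Fin m} {i′ j′ : Fin n} → SameOrder i j i′ j′ → i Fin.< j → i′ Fin.< j′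
sameOrder-< (less _ q)     i<j = q
sameOrder-< (equal refl _) i<j = contradiction i<j (ℕ.<-irrefl refl)
sameOrder-< (greater p _)  i<j = contradiction i<j (ℕ.<-asym p)

sameOrder-≡ : ∀ {m n} {i j : Fin m} {i′ j′ : Fin n} → SameOrder i j i′ j′ → i ≡ j → i′ ≡ j′
sameOrder-≡ (less p _)    refl = contradiction p (ℕ.<-irrefl refl)
sameOrder-≡ (equal _ q)   _    = q
sameOrder-≡ (greater p _) refl = contradiction p (ℕ.<-irrefl refl)

-- Each pebble is compared by itself, and of the two together only the order is kept. This suffices
-- because a quantifier moves one pebble and only the pebble that stays constrains the answer.
data Match (k : ℕ) (w w′ : List A) : Valuation w 2 → Valuation w′ 2 → Set where
  none : Match k w w′ (nothing ∷ nothing ∷ []) (nothing ∷ nothing ∷ [])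
  fst  : ∀ {i i′} → Sim k (word w) (word w′) i i′ →
         Match k w w′ (just i ∷ nothing ∷ []) (just i′ ∷ nothing ∷ [])
  snd  : ∀ {j j′} → Sim k (word w) (word w′) j j′ →
         Match k w w′ (nothing ∷ just j ∷ []) (nothing ∷ just j′ ∷ [])
  both : ∀ {i j i′ j′} → Sim k (word w) (word w′) i i′ → Sim k (word w) (word w′) j j′ →
         SameOrder i j i′ j′ → Match k w w′ (just i ∷ just j ∷ []) (just i′ ∷ just j′ ∷ [])

module _ {A : Set} where

  match-sym : ∀ {k} {u v : List A} {ν : Valuation u 2} {μ : Valuation v 2} →
              Match k u v ν μ → Match k v u μ ν
  match-sym none = none
  match-sym {k = k} (fst s) = fst (sim-sym k _ _ s)
  match-sym {k = k} (snd s) = snd (sim-sym k _ _ s)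
  match-sym {k = k} (both s t o) = both (sim-sym k _ _ s) (sim-sym k _ _ t) (sameOrder-sym o)

  match-order : ∀ {k} {u v : List A} {ν : Valuation u 2} {μ : Valuation v 2} →
                Match k u v ν μ → ∀ x y {i j} →
                Vec.lookup ν x ≡ just i → Vec.lookup ν y ≡ just j →
                ∃[ i′ ] ∃[ j′ ] (Vec.lookup μ x ≡ just i′ × Vec.lookup μ y ≡ just j′ ×
                  Sim k (word u) (word v) i i′ × SameOrder i j i′ j′)
  match-order (fst s)      zero       zero       refl refl =
    _ , _ , refl , refl , s , equal refl refl
  match-order (fst s)      zero       (suc zero) refl ()
  match-order (snd s)      (suc zero) (suc zero) refl refl =
    _ , _ , refl , refl , s , equal refl refl
  match-order (both s t o) zero       zero       refl refl =
    _ , _ , refl , refl , s , equal refl refl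
  match-order (both s t o) zero       (suc zero) refl refl =
    _ , _ , refl , refl , s , o
  match-order (both s t o) (suc zero) zero       refl refl =
    _ , _ , refl , refl , t , sameOrder-flip o
  match-order (both s t o) (suc zero) (suc zero) refl refl =
    _ , _ , refl , refl , t , equal refl refl

  -- The new pebble goes to the left of the old one, onto it or to its right. The strict cases are
  -- moves of the game; the remaining one reuses the old answer.
  answer : ∀ {k} (u v : List A) {j j′} → Sim (suc k) (word u) (word v) j j′ → ∀ i →
           ∃[ i′ ] (Sim k (word u) (word v) i i′ × SameOrder i j i′ j′)
  answer u v {j} {j′} (s , forth , _) i with Fin.<-cmp i j
  ... | tri< i<j _ _ = let (i′ , b , s′) = forth left i i<j in i′ , s′ , less i<j b
  ... | tri≈ _ refl _ = j′ , s , equal refl refl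
  ... | tri> _ _ j<i = let (i′ , b , s′) = forth right i j<i in i′ , s′ , greater j<i b

  -- If a pebble stays on the board, the game continues from it and its level drops by one. If the
  -- only pebble is lifted, or none was placed, the answer comes from the opening move in `e`.
  match-extend : ∀ {k} {u v : List A} {ν : Valuation u 2} {μ : Valuation v 2} →
                 word u ≈[ k ] word v → Match (suc k) u v ν μ → ∀ x i →
                 ∃[ i′ ] Match k u v (ν [ x ]≔ just i) (μ [ x ]≔ just i′)
  match-extend e none zero i = let (i′ , s) = forth e i in i′ , fst s
  match-extend e none (suc zero) i = let (i′ , s) = forth e i in i′ , snd s
  match-extend e (fst _) zero i = let (i′ , s) = forth e i in i′ , fst s
  match-extend {u = u} {v} e (fst t) (suc zero) i =
    let (i′ , s , o) = answer u v t i in i′ , both (proj₁ t) s (sameOrder-flip o)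
  match-extend {u = u} {v} e (snd t) zero i =
    let (i′ , s , o) = answer u v t i in i′ , both s (proj₁ t) o
  match-extend e (snd _) (suc zero) i = let (i′ , s) = forth e i in i′ , snd s
  match-extend {u = u} {v} e (both _ t _) zero i =
    let (i′ , s , o) = answer u v t i in i′ , both s (proj₁ t) o
  match-extend {u = u} {v} e (both t _ _) (suc zero) i =
    let (i′ , s , o) = answer u v t i in i′ , both (proj₁ t) s (sameOrder-flip o)

  transfer : ∀ {k} {u v : List A} {ν : Valuation u 2} {μ : Valuation v 2} φ → depth φ ℕ.≤ k →
             word u ≈[ k ] word v → Match k u v ν μ → u , ν ⊨ φ → v , μ ⊨ φ
  transfer {k = k} (P[ a ] x) _ e m (i , eq , a≡) =
    let (i′ , _ , eq′ , _ , s , _) = match-order m x x eq eq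
    in i′ , eq′ , trans (sym (sim-label k _ _ s)) a≡
  transfer (x ≺ y) _ e m (i , j , eqx , eqy , i<j) =
    let (i′ , j′ , eqx′ , eqy′ , _ , o) = match-order m x y eqx eqy
    in i′ , j′ , eqx′ , eqy′ , sameOrder-< o i<j
  transfer (x ≐ y) _ e m (i , eqx , eqy) =
    let (i′ , j′ , eqx′ , eqy′ , _ , o) = match-order m x y eqx eqy
    in i′ , eqx′ , trans eqy′ (cong just (sym (sameOrder-≡ o refl)))
  transfer (¬′ φ) d e m u⊭ v⊨ = u⊭ (transfer φ d (≈-sym e) (match-sym m) v⊨)
  transfer (φ ∧′ ψ) d e m (p , q) =
    transfer φ (ℕ.m⊔n≤o⇒m≤o _ _ d) e m p , transfer ψ (ℕ.m⊔n≤o⇒n≤o (depth φ) _ d) e m q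
  transfer (φ ∨′ ψ) d e m (inj₁ p) = inj₁ (transfer φ (ℕ.m⊔n≤o⇒m≤o _ _ d) e m p)
  transfer (φ ∨′ ψ) d e m (inj₂ q) = inj₂ (transfer ψ (ℕ.m⊔n≤o⇒n≤o (depth φ) _ d) e m q)
  transfer (∃′ x φ) (s≤s d) e m (i , p) =
    let (i′ , m′) = match-extend (≈-pred e) m x i
    in i′ , transfer φ d (≈-pred e) m′ p
  transfer (∀′ x φ) (s≤s d) e m p i′ =
    let (i , m′) = match-extend (≈-sym (≈-pred e)) (match-sym m) x i′
    in transfer φ d (≈-pred e) (match-sym m′) (p i)

  FO²-saturated : ∀ {K : Language A} → FO² K →
                  ∃[ k ] (∀ {u v} → u ∼[ k ] v → u ∈ᴸ K → v ∈ᴸ K)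
  FO²-saturated (φ , _ , defines) = depth φ , λ {u} {v} (equivalent e) u∈K →
    Equivalence.from (defines v)
      (transfer φ ℕ.≤-refl e none (Equivalence.to (defines u) u∈K))

-- Relativized formulas

relativize : ∀ {n} → (Fin n → Formula A n) → Formula A n → Formula A n
relativize θ (P[ a ] x) = P[ a ] x
relativize θ (x ≺ y)    = x ≺ y
relativize θ (x ≐ y)    = x ≐ y
relativize θ (¬′ φ)     = ¬′ relativize θ φ
relativize θ (φ ∧′ ψ)   = relativize θ φ ∧′ relativize θ ψ
relativize θ (φ ∨′ ψ)   = relativize θ φ ∨′ relativize θ ψ
relativize θ (∃′ x φ)   = ∃′ x (θ x ∧′ relativize θ φ)
relativize θ (∀′ x φ)   = ∀′ x ((¬′ θ x) ∨′ relativize θ φ)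

record Embedding (u w : List A) : Set where
  field
    to       : Pos (word u) → Pos (word w)
    to-label : ∀ i → List.lookup w (to i) ≡ List.lookup u i
    mono     : ∀ {i j} → i Fin.< j → to i Fin.< to j
    cancel   : ∀ {i j} → to i Fin.< to j → i Fin.< j

  injective : ∀ {i j} → to i ≡ to j → i ≡ j
  injective {i} {j} eq with Fin.<-cmp i j
  ... | tri< i<j _ _ = contradiction (mono i<j) (ℕ.<-irrefl (cong Fin.toℕ eq))
  ... | tri≈ _ i≡j _ = i≡j
  ... | tri> _ _ j<i = contradiction (mono j<i) (ℕ.<-irrefl (cong Fin.toℕ (sym eq)))

  push : ∀ {n} → Valuation u n → Valuation w n
  push = Vec.map (Maybe.map to)

  push⁺ : ∀ {n} (ν : Valuation u n) x {i} →
          Vec.lookup ν x ≡ just i → Vec.lookup (push ν) x ≡ just (to i)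
  push⁺ ν x eq = trans (Vec.lookup-map x _ ν) (cong (Maybe.map to) eq)

  push⁻ : ∀ {n} (ν : Valuation u n) x {i} →
          Vec.lookup (push ν) x ≡ just i → ∃[ j ] (Vec.lookup ν x ≡ just j × to j ≡ i)
  push⁻ (just j ∷ ν)  zero    refl = j , refl , refl
  push⁻ (_ ∷ ν)       (suc x) eq   = push⁻ ν x eq

module _ {A : Set} {u w : List A} (f : Embedding u w) where

  open Embedding f

  -- Stated as a decision rather than as an equivalence: a relativized `∀′` is a disjunction, and
  -- its proof must know for each position which side holds. The valuation is arbitrary at the other
  -- names, because guards are evaluated in the midst of a formula.
  Defines : ∀ {n} → (Fin n → Formula A n) → Set
  Defines {n} θ = ∀ x (ν : Valuation w n) i → Vec.lookup ν x ≡ just i →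
    (∃[ j ] to j ≡ i × (w , ν ⊨ θ x)) ⊎ ((∀ j → to j ≢ i) × ¬ (w , ν ⊨ θ x))

  module _ {n} {θ : Fin n → Formula A n} (def : Defines θ) where

    guard : ∀ x (ν : Valuation u n) i → w , push ν [ x ]≔ just (to i) ⊨ θ x
    guard x ν i with def x (push ν [ x ]≔ just (to i)) (to i) (Vec.lookup∘update x (push ν) _)
    ... | inj₁ (_ , _ , p) = p
    ... | inj₂ (∉ , _)     = contradiction refl (∉ i)

    unguard : ∀ x (ν : Valuation u n) i → w , push ν [ x ]≔ just i ⊨ θ x → ∃[ j ] to j ≡ i
    unguard x ν i p with def x (push ν [ x ]≔ just i) i (Vec.lookup∘update x (push ν) _)
    ... | inj₁ (j , eq , _) = j , eq
    ... | inj₂ (_ , ¬p)     = contradiction p ¬p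

    push-≔ : ∀ (ν : Valuation u n) x i → push (ν [ x ]≔ just i) ≡ push ν [ x ]≔ just (to i)
    push-≔ ν x i = Vec.map-[]≔ (Maybe.map to) ν x

    relativize⁺ : ∀ φ ν → u , ν ⊨ φ → w , push ν ⊨ relativize θ φ
    relativize⁻ : ∀ φ ν → w , push ν ⊨ relativize θ φ → u , ν ⊨ φ

    relativize⁺ (P[ a ] x) ν (i , eq , eqₐ) = to i , push⁺ ν x eq , trans (to-label i) eqₐ
    relativize⁺ (x ≺ y) ν (i , j , eqx , eqy , i<j) =
      to i , to j , push⁺ ν x eqx , push⁺ ν y eqy , mono i<j
    relativize⁺ (x ≐ y) ν (i , eqx , eqy) = to i , push⁺ ν x eqx , push⁺ ν y eqy
    relativize⁺ (¬′ φ) ν ¬p q = ¬p (relativize⁻ φ ν q)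
    relativize⁺ (φ ∧′ ψ) ν (p , q) = relativize⁺ φ ν p , relativize⁺ ψ ν q
    relativize⁺ (φ ∨′ ψ) ν = Sum.map (relativize⁺ φ ν) (relativize⁺ ψ ν)
    relativize⁺ (∃′ x φ) ν (i , p) =
      to i , guard x ν i
           , subst (w ,_⊨ relativize θ φ) (push-≔ ν x i) (relativize⁺ φ (ν [ x ]≔ just i) p)
    relativize⁺ (∀′ x φ) ν p i with def x (push ν [ x ]≔ just i) i (Vec.lookup∘update x (push ν) _)
    ... | inj₁ (j , refl , _) =
      inj₂ (subst (w ,_⊨ relativize θ φ) (push-≔ ν x j) (relativize⁺ φ (ν [ x ]≔ just j) (p j)))
    ... | inj₂ (_ , ¬θ) = inj₁ ¬θ

    relativize⁻ (P[ a ] x) ν (i , eq , eqₐ) with push⁻ ν x eq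
    ... | j , eqj , refl = j , eqj , trans (sym (to-label j)) eqₐ
    relativize⁻ (x ≺ y) ν (i , j , eqx , eqy , i<j) with push⁻ ν x eqx | push⁻ ν y eqy
    ... | i′ , eqi , refl | j′ , eqj , refl = i′ , j′ , eqi , eqj , cancel i<j
    relativize⁻ (x ≐ y) ν (i , eqx , eqy) with push⁻ ν x eqx | push⁻ ν y eqy
    ... | i′ , eqi , refl | j′ , eqj , eq =
      i′ , eqi , trans eqj (cong just (injective eq))
    relativize⁻ (¬′ φ) ν ¬p q = ¬p (relativize⁺ φ ν q)
    relativize⁻ (φ ∧′ ψ) ν (p , q) = relativize⁻ φ ν p , relativize⁻ ψ ν q
    relativize⁻ (φ ∨′ ψ) ν = Sum.map (relativize⁻ φ ν) (relativize⁻ ψ ν)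
    relativize⁻ (∃′ x φ) ν (i , g , p) with unguard x ν i g
    ... | j , refl =
      j , relativize⁻ φ (ν [ x ]≔ just j) (subst (w ,_⊨ relativize θ φ) (sym (push-≔ ν x j)) p)
    relativize⁻ (∀′ x φ) ν p j with p (to j)
    ... | inj₁ ¬g = contradiction (guard x ν j) ¬g
    ... | inj₂ q  =
      relativize⁻ φ (ν [ x ]≔ just j) (subst (w ,_⊨ relativize θ φ) (sym (push-≔ ν x j)) q)

-- Cutting a word at the first or last occurrence of a letter

other : Fin 2 → Fin 2
other zero       = suc zero
other (suc zero) = zero

beside : Side → Fin 2 → Fin 2 → Formula A 2
beside left  x y = y ≺ x
beside right x y = x ≺ y

-- Requantifying `other x` keeps the guards within two names and leaves just x free. For a cut at
-- the first (or last) a, `fresh` holds exactly at the near positions and `seen` exactly at the far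
-- ones; the pivot satisfies neither.
seen fresh : Side → A → Fin 2 → Formula A 2
seen d a x  = ∃′ (other x) (beside d x (other x) ∧′ P[ a ] (other x))
fresh d a x = (¬′ seen d a x) ∧′ (¬′ P[ a ] x)

-- The first conjunct provides an a to cut at: by it `cut-sound` rules out the words without a.
cut : Side → A → Formula A 2 → Formula A 2 → Formula A 2
cut d a φ ψ = ∃′ zero (P[ a ] zero) ∧′ (relativize (fresh d a) φ ∧′ relativize (seen d a) ψ)

-- A cut on the left is at the first a, so that the near factor u avoids a; a cut on the right
-- is at the last a.
near far : Side → List A → List A → List A
near left  u v = u
near right u v = v
far  left  u v = v
far  right u v = u

module _ {A : Set} {w : List A} where

  lookup-other : ∀ x (ν : Valuation w 2) {m} → Vec.lookup (ν [ other x ]≔ m) x ≡ Vec.lookup ν x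
  lookup-other zero       (_ ∷ _ ∷ []) = refl
  lookup-other (suc zero) (_ ∷ _ ∷ []) = refl

  seen⁺ : ∀ d a x (ν : Valuation w 2) {i j} → Vec.lookup ν x ≡ just i →
          Beside (word w) d i j → List.lookup w j ≡ a → w , ν ⊨ seen d a x
  seen⁺ left  a x ν {i} {j} eq b eqₐ =
    let y = Vec.lookup∘update (other x) ν (just j)
    in j , (j , i , y , trans (lookup-other x ν) eq , b) , j , y , eqₐ
  seen⁺ right a x ν {i} {j} eq b eqₐ =
    let y = Vec.lookup∘update (other x) ν (just j)
    in j , (i , j , trans (lookup-other x ν) eq , y , b) , j , y , eqₐ

  seen⁻ : ∀ d a x (ν : Valuation w 2) {i} → Vec.lookup ν x ≡ just i → w , ν ⊨ seen d a x →
          ∃[ j ] (Beside (word w) d i j × List.lookup w j ≡ a)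
  seen⁻ left  a x ν eq (j , (j′ , i′ , eqj , eqi , b) , k , eqk , eqₐ)
    with trans (sym (Vec.lookup∘update (other x) ν _)) eqj
       | trans (sym eq) (trans (sym (lookup-other x ν)) eqi)
       | trans (sym (Vec.lookup∘update (other x) ν _)) eqk
  ... | refl | refl | refl = j , b , eqₐ
  seen⁻ right a x ν eq (j , (i′ , j′ , eqi , eqj , b) , k , eqk , eqₐ)
    with trans (sym (Vec.lookup∘update (other x) ν _)) eqj
       | trans (sym eq) (trans (sym (lookup-other x ν)) eqi)
       | trans (sym (Vec.lookup∘update (other x) ν _)) eqk
  ... | refl | refl | refl = j , b , eqₐ

module _ {A : Set} (u : List A) (a : A) (v : List A) where

  private
    w : List A
    w = u ++ a ∷ v
    at : Pos (word u ⊕ word (a ∷ v)) → Pos (word w)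
    at = join u (a ∷ v)
    order : ∀ x y → at x Fin.< at y → Structure._<_ (word u ⊕ word (a ∷ v)) x y
    order = join-cancel-< u (a ∷ v)

  left-embedding : Embedding u w
  left-embedding = record
    { to       = λ p → at (inj₁ p)
    ; to-label = λ p → sym (join-label u (a ∷ v) (inj₁ p))
    ; mono     = λ {i} {j} → join-mono u (a ∷ v) (inj₁ i) (inj₁ j)
    ; cancel   = λ {i} {j} → order (inj₁ i) (inj₁ j)
    }

  right-embedding : Embedding v w
  right-embedding = record
    { to       = λ p → at (inj₂ (suc p))
    ; to-label = λ p → sym (join-label u (a ∷ v) (inj₂ (suc p)))
    ; mono     = λ {i} {j} i<j → join-mono u (a ∷ v) (inj₂ (suc i)) (inj₂ (suc j)) (s≤s i<j)
    ; cancel   = λ {i} {j} lt → ℕ.s<s⁻¹ (order (inj₂ (suc i)) (inj₂ (suc j)) lt)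
    }

  near-embedding : ∀ d → Embedding (near d u v) w
  near-embedding left  = left-embedding
  near-embedding right = right-embedding

  far-embedding : ∀ d → Embedding (far d u v) w
  far-embedding left  = right-embedding
  far-embedding right = left-embedding

  pivot : Pos (word w)
  pivot = at (inj₂ zero)

  pivot-label : List.lookup w pivot ≡ a
  pivot-label = sym (join-label u (a ∷ v) (inj₂ zero))

  module _ (d : Side) where

    open Embedding (near-embedding d) using () renaming (to to toⁿ)
    open Embedding (far-embedding d) using () renaming (to to toᶠ)

    data Place (i : Pos (word w)) : Set where
      is-near  : ∀ p → toⁿ p ≡ i → Place i
      is-pivot : pivot ≡ i → Place i
      is-far   : ∀ p → toᶠ p ≡ i → Place i

  place : ∀ d i → Place d i
  place d i with split u (a ∷ v) i | join-split u (a ∷ v) i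
  place left  i | inj₁ p       | eq = is-near p eq
  place left  i | inj₂ zero    | eq = is-pivot eq
  place left  i | inj₂ (suc p) | eq = is-far p eq
  place right i | inj₁ p       | eq = is-far p eq
  place right i | inj₂ zero    | eq = is-pivot eq
  place right i | inj₂ (suc p) | eq = is-near p eq

  beside-pivot : ∀ d j → Beside (word w) d pivot j →
                 ∃[ q ] Embedding.to (near-embedding d) q ≡ j
  beside-pivot d j b with place d j
  beside-pivot d     j b | is-near q eq     = q , eq
  beside-pivot d     j b | is-pivot refl    = contradiction b (irrefl d)
    where
    irrefl : ∀ d → ¬ Beside (word w) d pivot pivot
    irrefl left  = ℕ.<-irrefl refl
    irrefl right = ℕ.<-irrefl refl
  beside-pivot left  j b | is-far q refl with () ← order (inj₂ (suc q)) (inj₂ zero) b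
  beside-pivot right j b | is-far q refl with () ← order (inj₂ zero) (inj₁ q) b

  beside-near : ∀ d p j → Beside (word w) d (Embedding.to (near-embedding d) p) j →
                ∃[ q ] Embedding.to (near-embedding d) q ≡ j
  beside-near d p j b with place d j
  beside-near d     p j b | is-near q eq = q , eq
  beside-near left  p j b | is-pivot refl with () ← order (inj₂ zero) (inj₁ p) b
  beside-near right p j b | is-pivot refl with () ← order (inj₂ (suc p)) (inj₂ zero) b
  beside-near left  p j b | is-far q refl with () ← order (inj₂ (suc q)) (inj₁ p) b
  beside-near right p j b | is-far q refl with () ← order (inj₂ (suc p)) (inj₁ q) b

  beside-far : ∀ d p → Beside (word w) d (Embedding.to (far-embedding d) p) pivot
  beside-far left  p = join-mono u (a ∷ v) (inj₂ zero) (inj₂ (suc p)) ℕ.z<s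
  beside-far right p = join-mono u (a ∷ v) (inj₁ p) (inj₂ zero) tt

  module _ (d : Side) (a∉ : All (_≢ a) (near d u v)) where

    open Embedding (near-embedding d) using () renaming (to to toⁿ; to-label to toⁿ-label)
    open Embedding (far-embedding d) using () renaming (to to toᶠ)

    near-label : ∀ p → List.lookup w (toⁿ p) ≢ a
    near-label p eq = All.lookup a∉ (List.∈-lookup p) (trans (sym (toⁿ-label p)) eq)

    unseen : ∀ {j} → ∃[ q ] toⁿ q ≡ j → List.lookup w j ≢ a
    unseen (q , refl) = near-label q

    -- Otherwise the pivot would lie beside a near position and so be near itself, whereas no near
    -- position carries a.
    near≢far : ∀ p q → toⁿ p ≢ toᶠ q
    near≢far p q eq = unseen
      (beside-near d p pivot (subst (λ i → Beside (word w) d i pivot) (sym eq) (beside-far d q)))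
      pivot-label

    defines-fresh : Defines (near-embedding d) (fresh d a)
    defines-fresh x ν i eq with place d i
    ... | is-near p refl = inj₁ (p , refl , not-seen , not-a)
      where
      not-seen : ¬ (w , ν ⊨ seen d a x)
      not-seen s = let (j , b , eqₐ) = seen⁻ d a x ν eq s in unseen (beside-near d p j b) eqₐ
      not-a : ¬ (w , ν ⊨ P[ a ] x)
      not-a (i , eqᵢ , eqₐ) with refl ← trans (sym eq) eqᵢ = near-label p eqₐ
    ... | is-pivot refl = inj₂
      ( (λ p eqₚ → near-label p (trans (cong (List.lookup w) eqₚ) pivot-label))
      , (λ (_ , ¬a) → ¬a (pivot , eq , pivot-label)) )
    ... | is-far q refl = inj₂
      ( (λ p → near≢far p q)
      , (λ (¬seen , _) → ¬seen (seen⁺ d a x ν eq (beside-far d q) pivot-label)) )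

    defines-seen : Defines (far-embedding d) (seen d a)
    defines-seen x ν i eq with place d i
    ... | is-near p refl = inj₂
      ( (λ q eq′ → near≢far p q (sym eq′))
      , (λ s → let (j , b , eqₐ) = seen⁻ d a x ν eq s in unseen (beside-near d p j b) eqₐ) )
    ... | is-pivot refl = inj₂
      ( (λ q eq′ → far≢pivot q eq′)
      , (λ s → let (j , b , eqₐ) = seen⁻ d a x ν eq s in unseen (beside-pivot d j b) eqₐ) )
      where
      far≢pivot : ∀ q → toᶠ q ≢ pivot
      far≢pivot q eq′ = unseen
        (beside-pivot d pivot (subst (λ i → Beside (word w) d i pivot) eq′ (beside-far d q)))
        pivot-label
    ... | is-far q refl = inj₁ (q , refl , seen⁺ d a x ν eq (beside-far d q) pivot-label)

    cut⁺ : ∀ {φ ψ} → near d u v ⊨ φ → far d u v ⊨ ψ → w ⊨ cut d a φ ψ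
    cut⁺ {φ} {ψ} p q =
        (pivot , pivot , refl , pivot-label)
      , relativize⁺ (near-embedding d) defines-fresh φ _ p
      , relativize⁺ (far-embedding d) defines-seen ψ _ q

    cut⁻ : ∀ {φ ψ} → w ⊨ cut d a φ ψ → near d u v ⊨ φ × far d u v ⊨ ψ
    cut⁻ {φ} {ψ} (_ , p , q) =
        -- The empty valuation is mapped to the empty valuation by computation.
        relativize⁻ (near-embedding d) defines-fresh φ (Vec.replicate _ nothing) p
      , relativize⁻ (far-embedding d) defines-seen ψ (Vec.replicate _ nothing) q

record Cut (d : Side) (a : A) (w : List A) : Set where
  constructor ⟨_,_⟩
  field
    {before after} : List A
    factors : w ≡ before ++ a ∷ after
    avoids  : All (_≢ a) (near d before after)

find-cut : DecidableEquality A → ∀ d a (w : List A) → All (_≢ a) w ⊎ Cut d a w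
find-cut _≟_ d     a []      = inj₁ []
find-cut _≟_ left  a (b ∷ w) with b ≟ a | find-cut _≟_ left a w
... | yes refl | _                   = inj₂ (⟨_,_⟩ {before = []} refl [])
... | no b≢a   | inj₁ a∉w            = inj₁ (b≢a ∷ a∉w)
... | no b≢a   | inj₂ ⟨ refl , a∉u ⟩ = inj₂ ⟨ refl , b≢a ∷ a∉u ⟩
-- The result for the tail takes precedence, so that the last a is found.
find-cut _≟_ right a (b ∷ w) with find-cut _≟_ right a w | b ≟ a
... | inj₂ ⟨ refl , a∉v ⟩ | _        = inj₂ (⟨_,_⟩ {before = b ∷ _} refl a∉v)
... | inj₁ a∉w            | yes refl = inj₂ (⟨_,_⟩ {before = []} refl a∉w)
... | inj₁ a∉w            | no b≢a   = inj₁ (b≢a ∷ a∉w)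

cut-sound : DecidableEquality A → ∀ d {a} {w : List A} {φ ψ} → w ⊨ cut d a φ ψ →
            Σ[ c ∈ Cut d a w ] (near d (Cut.before c) (Cut.after c) ⊨ φ ×
                                far d (Cut.before c) (Cut.after c) ⊨ ψ)
cut-sound _≟_ d {a} {w} {φ} {ψ} p@((i , j , _ , eqₐ) , _) with find-cut _≟_ d a w
... | inj₁ a∉w = contradiction eqₐ (All.lookup a∉w (List.∈-lookup j))
... | inj₂ c@(⟨_,_⟩ {u} {v} refl a∉) = c , cut⁻ u a v d a∉ {φ} {ψ} p

-- Free names, and a sentence for the words over a subalphabet

sentence-∧ : ∀ {n} (φ ψ : Formula A n) → Sentence φ → Sentence ψ → Sentence (φ ∧′ ψ)
sentence-∧ φ ψ s t (x , x∈) = [ (λ x∈φ → s (x , x∈φ)) , (λ x∈ψ → t (x , x∈ψ)) ]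
  (Subset.x∈p∪q⁻ (free φ) (free ψ) x∈)

-- The guard of a relativized quantifier adds only the name being bound, so the free names do not
-- change.
absorb : ∀ (x : Fin 2) p → (Subset.⁅ x ⁆ Subset.∪ p) Subset.- x ≡ p Subset.- x
absorb zero       (_ ∷ _ ∷ []) = refl
absorb (suc zero) (_ ∷ _ ∷ []) = refl

free-relativize : (θ : Fin 2 → Formula A 2) → (∀ x → free (θ x) ≡ Subset.⁅ x ⁆) →
                  ∀ φ → free (relativize θ φ) ≡ free φ
free-relativize θ eq (P[ a ] x) = refl
free-relativize θ eq (x ≺ y)    = refl
free-relativize θ eq (x ≐ y)    = refl
free-relativize θ eq (¬′ φ)     = free-relativize θ eq φ
free-relativize θ eq (φ ∧′ ψ)   = cong₂ Subset._∪_ (free-relativize θ eq φ) (free-relativize θ eq ψ)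
free-relativize θ eq (φ ∨′ ψ)   = cong₂ Subset._∪_ (free-relativize θ eq φ) (free-relativize θ eq ψ)
free-relativize θ eq (∃′ x φ)   =
  trans (cong₂ (λ p q → (p Subset.∪ q) Subset.- x) (eq x) (free-relativize θ eq φ))
    (absorb x (free φ))
free-relativize θ eq (∀′ x φ)   =
  trans (cong₂ (λ p q → (p Subset.∪ q) Subset.- x) (eq x) (free-relativize θ eq φ))
    (absorb x (free φ))

sentence-cut : ∀ d (a : A) φ ψ → Sentence φ → Sentence ψ → Sentence (cut d a φ ψ)
sentence-cut d a φ ψ s t = sentence-∧ (∃′ zero (P[ a ] zero))
  (relativize (fresh d a) φ ∧′ relativize (seen d a) ψ) occurs
  (sentence-∧ (relativize (fresh d a) φ) (relativize (seen d a) ψ)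
    (subst Subset.Empty (sym (free-relativize (fresh d a) (free-fresh d) φ)) s)
    (subst Subset.Empty (sym (free-relativize (seen d a) (free-seen d) ψ)) t))
  where
  occurs : Sentence (∃′ {n = 2} zero (P[ a ] zero))
  occurs (x , x∈) = Subset.∉⊥ x∈
  free-seen : ∀ d x → free (seen d a x) ≡ Subset.⁅ x ⁆
  free-seen left  zero       = refl
  free-seen left  (suc zero) = refl
  free-seen right zero       = refl
  free-seen right (suc zero) = refl
  free-fresh : ∀ d x → free (fresh d a x) ≡ Subset.⁅ x ⁆
  free-fresh left  zero       = refl
  free-fresh left  (suc zero) = refl
  free-fresh right zero       = refl
  free-fresh right (suc zero) = refl

-- A universal sentence, so that it holds in the empty word as well.
always : Formula A 2
always = ∀′ zero (zero ≐ zero)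

avoid : List A → Formula A 2
avoid []       = always
avoid (a ∷ as) = (¬′ ∃′ zero (P[ a ] zero)) ∧′ avoid as

sentence-avoid : (as : List A) → Sentence (avoid as)
sentence-avoid []       (x , x∈) = Subset.∉⊥ x∈
sentence-avoid (a ∷ as) = sentence-∧ (¬′ ∃′ zero (P[ a ] zero)) (avoid as)
  (λ (x , x∈) → Subset.∉⊥ x∈) (sentence-avoid as)

avoid⁺ : (as : List A) {w : List A} → All (λ b → All (b ≢_) as) w → w ⊨ avoid as
avoid⁺ []       all i = i , refl , refl
avoid⁺ (a ∷ as) all =
    (λ (_ , j , _ , eq) → All.lookup (All.map All.head all) (List.∈-lookup j) eq)
  , avoid⁺ as (All.map All.tail all)

avoid⁻ : (as : List A) {w : List A} → w ⊨ avoid as → All (λ b → All (b ≢_) as) w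
avoid⁻ []       _        = All.universal (λ _ → []) _
avoid⁻ (a ∷ as) (¬a , p) = All.zipWith (λ (b≢a , b≢as) → b≢a ∷ b≢as)
  (All.tabulate (λ b∈w eq → ¬a (Any.index b∈w , Any.index b∈w , refl ,
      trans (sym (Any.lookup-index b∈w)) eq))
  , avoid⁻ as p)

-- Pairs of an alphabet and a relation between states

module Runs (A Q : Set) (E : Q → A → Q → Set) where

  private
    variable
      p q r : Q
      a : A
      u v w : List A

  infixr 5 _∷_

  data Path : Q → List A → Q → Set where
    []  : Path p [] p
    _∷_ : E p a q → Path q w r → Path p (a ∷ w) r

  _++ᴾ_ : Path p u q → Path q v r → Path p (u ++ v) r
  []      ++ᴾ ρ = ρ
  (e ∷ π) ++ᴾ ρ = e ∷ (π ++ᴾ ρ)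

  split-path : ∀ u → Path p (u ++ v) r → ∃[ q ] (Path p u q × Path q v r)
  split-path []      π       = _ , [] , π
  split-path (a ∷ u) (e ∷ π) = let (q , ρ , σ) = split-path u π in q , e ∷ ρ , σ

record Ends (Q : Set) : Set₁ where
  field
    {initial final} : Q → Set
    initial?        : Decidable initial
    final?          : Decidable final

module Automaton
  (A Q : Set) ⦃ finite-A : Finite A ⦄ ⦃ finite-Q : Finite Q ⦄
  (E : Q → A → Q → Set) (E? : ∀ p a q → Dec (E p a q))
  where

  private
    variable
      p q r : Q
      a b : A
      u v w : List A

  open Runs A Q E public

  -- Subalphabets

  Alphabet : Set
  Alphabet = Sub A

  private
    variable
      B C D U : Alphabet

  infix 4 _⊆_

  _⊆_ : Alphabet → Alphabet → Set
  B ⊆ C = ∀ a → a ∈ B → a ∈ C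

  _⊆?_ : ∀ B C → Dec (B ⊆ C)
  B ⊆? C = forall? (λ a → a ∈? B →-dec a ∈? C)

  infixr 6 _∪_

  opaque
    ∅ : Alphabet
    ∅ = ⟪ (λ _ → no id) ⟫

    ⁅_⁆ : A → Alphabet
    ⁅ a ⁆ = ⟪ _≟ a ⟫

    _∪_ _∖_ : Alphabet → Alphabet → Alphabet
    B ∪ C = ⟪ (λ a → a ∈? B ⊎-dec a ∈? C) ⟫
    B ∖ C = ⟪ (λ a → a ∈? B ×-dec ¬? (a ∈? C)) ⟫

    ∉∅ : ¬ a ∈ ∅
    ∉∅ = ∈⟪⟫⁻ (λ _ → no id)

    ∅-⊆ : ∅ ⊆ B
    ∅-⊆ _ a∈ = contradiction a∈ ∉∅

    ∈⁅⁆ : a ∈ ⁅ a ⁆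
    ∈⁅⁆ = ∈⟪⟫⁺ _ refl

    ∈⁅⁆⁻ : b ∈ ⁅ a ⁆ → b ≡ a
    ∈⁅⁆⁻ {a = a} = ∈⟪⟫⁻ (_≟ a)

    ∈∪⁺ : a ∈ B ⊎ a ∈ C → a ∈ B ∪ C
    ∈∪⁺ = ∈⟪⟫⁺ _

    ∈∪⁻ : a ∈ B ∪ C → a ∈ B ⊎ a ∈ C
    ∈∪⁻ {B = B} {C} = ∈⟪⟫⁻ (λ a → a ∈? B ⊎-dec a ∈? C)

    ∪-⊆ : B ⊆ U → C ⊆ U → B ∪ C ⊆ U
    ∪-⊆ B⊆U C⊆U a a∈ = Sum.[ B⊆U a , C⊆U a ] (∈∪⁻ a∈)

    ∈∖⁺ : a ∈ B → ¬ a ∈ C → a ∈ B ∖ C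
    ∈∖⁺ a∈B a∉C = ∈⟪⟫⁺ _ (a∈B , a∉C)

    ∈∖⁻ : a ∈ B ∖ C → a ∈ B × ¬ a ∈ C
    ∈∖⁻ {B = B} {C} = ∈⟪⟫⁻ (λ a → a ∈? B ×-dec ¬? (a ∈? C))

  -- The monoid of relations between states

  Rel : Set
  Rel = Sub (Q × Q)

  private
    variable
      e f s t x y z : Rel

  infixr 7 _·_

  opaque
    identity : Rel
    identity = ⟪ (λ (p , q) → p ≟ q) ⟫

    step : A → Rel
    step a = ⟪ (λ (p , q) → E? p a q) ⟫

    _·_ : Rel → Rel → Rel
    r · s = ⟪ (λ (p , q) → exists? (λ m → (p , m) ∈? r ×-dec (m , q) ∈? s)) ⟫

    ∈identity⁺ : (p , p) ∈ identity
    ∈identity⁺ = ∈⟪⟫⁺ _ refl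

    ∈identity⁻ : (p , q) ∈ identity → p ≡ q
    ∈identity⁻ = ∈⟪⟫⁻ (λ (p , q) → p ≟ q)

    ∈step⁺ : E p a q → (p , q) ∈ step a
    ∈step⁺ = ∈⟪⟫⁺ _

    ∈step⁻ : (p , q) ∈ step a → E p a q
    ∈step⁻ {a = a} = ∈⟪⟫⁻ (λ (p , q) → E? p a q)

    ∈·⁺ : (p , q) ∈ x → (q , r) ∈ y → (p , r) ∈ x · y
    ∈·⁺ pq qr = ∈⟪⟫⁺ _ (_ , pq , qr)

    ∈·⁻ : (p , r) ∈ x · y → ∃[ q ] ((p , q) ∈ x × (q , r) ∈ y)
    ∈·⁻ {x = x} {y} = ∈⟪⟫⁻ (λ (p , q) → exists? (λ m → (p , m) ∈? x ×-dec (m , q) ∈? y))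

  ·-assoc : ∀ x y z → (x · y) · z ≡ x · (y · z)
  ·-assoc x y z = ⊆-antisym
    (λ _ xyz → let (_ , xy , z) = ∈·⁻ xyz ; (_ , x , y) = ∈·⁻ xy in ∈·⁺ x (∈·⁺ y z))
    (λ _ xyz → let (_ , x , yz) = ∈·⁻ xyz ; (_ , y , z) = ∈·⁻ yz in ∈·⁺ (∈·⁺ x y) z)

  ·-identityˡ : ∀ x → identity · x ≡ x
  ·-identityˡ x = ⊆-antisym
    (λ _ x∈ → let (_ , i , x∋) = ∈·⁻ x∈ in subst (λ p → (p , _) ∈ x) (sym (∈identity⁻ i)) x∋)
    (λ _ x∋ → ∈·⁺ ∈identity⁺ x∋)

  ·-identityʳ : ∀ x → x · identity ≡ x
  ·-identityʳ x = ⊆-antisym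
    (λ _ x∈ → let (_ , x∋ , i) = ∈·⁻ x∈ in subst (λ q → (_ , q) ∈ x) (∈identity⁻ i) x∋)
    (λ _ x∋ → ∈·⁺ x∋ ∈identity⁺)

  Star : Alphabet → Rel → Set
  Star B g = (∀ p → (p , p) ∈ g) ×
             (∀ p q r a → (p , q) ∈ g → a ∈ B → E q a r → (p , r) ∈ g)

  Star? : ∀ B g → Dec (Star B g)
  Star? B g = forall? (λ p → (p , p) ∈? g) ×-dec
    forall? (λ p → forall? (λ q → forall? (λ r → forall? (λ a →
      (p , q) ∈? g →-dec (a ∈? B →-dec (E? q a r →-dec (p , r) ∈? g))))))

  opaque
    -- Reachability by words over B, given as an intersection over the finitely many relations so
    -- that exhaustive search decides it. No word can be read off from membership, which is why
    -- `star-reach` asks for a decision of `Reach`.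
    star : Alphabet → Rel
    star B = ⟪ (λ pq → forall? (λ g → Star? B g →-dec pq ∈? g)) ⟫

    star-least : ∀ B g → Star B g → (p , q) ∈ star B → (p , q) ∈ g
    star-least B g closed pq = ∈⟪⟫⁻ (λ pq → forall? (λ g → Star? B g →-dec pq ∈? g)) pq g closed

    star-path : All (_∈ B) w → Path p w q → (p , q) ∈ star B
    star-path B* π = ∈⟪⟫⁺ _ (λ g closed → extend g closed B* π (proj₁ closed _))
      where
      extend : ∀ g → Star B g → All (_∈ B) w → Path q w r → (p , q) ∈ g → (p , r) ∈ g
      extend g closed []         []      pq = pq
      extend g closed (a∈B ∷ B*) (e ∷ π) pq =
        extend g closed B* π (proj₂ closed _ _ _ _ pq a∈B e)

  -- The least closed family of pairs

  record Closed (P : Alphabet → Rel → Set) : Set where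
    field
      unit    : P ∅ identity
      letter  : ∀ a → P ⁅ a ⁆ (step a)
      product : ∀ B C x y → P B x → P C y → P (B ∪ C) (x · y)
      stable  : ∀ C B D e s t f → P C e → P B s → P B t → P D f →
                e · s ≡ e → t · f ≡ f → P (C ∪ B ∪ D) (e · star B · f)

  Closed? : ∀ {P} → (∀ B x → Dec (P B x)) → Dec (Closed P)
  Closed? {P} P? = map′
    (λ (u , l , m , s) → record { unit = u ; letter = l ; product = m ; stable = s })
    (λ c → let open Closed c in unit , letter , product , stable)
    (P? _ _
      ×-dec forall? (λ a → P? _ _)
      ×-dec forall? (λ B → forall? (λ C → forall? (λ x → forall? (λ y →
        P? B x →-dec (P? C y →-dec P? _ _)))))
      ×-dec forall? (λ C → forall? (λ B → forall? (λ D →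
        forall? (λ e → forall? (λ s → forall? (λ t → forall? (λ f →
        P? C e →-dec (P? B s →-dec (P? B t →-dec (P? D f →-dec
        ((e · s ≟ e) →-dec ((t · f ≟ f) →-dec P? _ _)))))))))))))

  Family : Set
  Family = Sub (Alphabet × Rel)

  Generated : Alphabet → Rel → Set
  Generated B x = ∀ (F : Family) → Closed (λ C y → (C , y) ∈ F) → (B , x) ∈ F

  opaque
    Generated? : ∀ B x → Dec (Generated B x)
    Generated? B x =
      forall? (λ (F : Family) → Closed? (λ C y → (C , y) ∈? F) →-dec (B , x) ∈? F)

  generated : Closed Generated
  generated = record
    { unit    = λ F c → Closed.unit c
    ; letter  = λ a F c → Closed.letter c a
    ; product = λ B C x y p q F c → Closed.product c B C x y (p F c) (q F c)
    ; stable  = λ C B D e s t f p q r o es tf F c →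
        Closed.stable c C B D e s t f (p F c) (q F c) (r F c) (o F c) es tf
    }

  -- `Generated` ranges only over families stored as finite subsets, so P must be decided in order
  -- to become one of them.
  generated-least : ∀ {P} → (∀ B x → Dec (P B x)) → Closed P → ∀ {B x} → Generated B x → P B x
  generated-least {P} P? c {B} {x} g = out (g F record
    { unit    = into (Closed.unit c)
    ; letter  = λ a → into (Closed.letter c a)
    ; product = λ B C x y p q → into (Closed.product c B C x y (out p) (out q))
    ; stable  = λ C B D e s t f p q r o es tf →
        into (Closed.stable c C B D e s t f (out p) (out q) (out r) (out o) es tf)
    })
    where
    F : Family
    F = ⟪ (λ (C , y) → P? C y) ⟫
    into : ∀ {C y} → P C y → (C , y) ∈ F
    into = ∈⟪⟫⁺ _
    out : ∀ {C y} → (C , y) ∈ F → P C y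
    out = ∈⟪⟫⁻ (λ (C , y) → P? C y)

  -- Realizing generated pairs by equivalent words

  Spells : Alphabet → List A → Set
  Spells B w = ∀ a → a ∈ B ⇔ a ∈ₗ w

  -- A single u serves all pairs of x. Words read along different pairs are thus equivalent to each
  -- other, and a language saturated at level k contains all of them or none.
  Realizes : ℕ → Rel → List A → Set
  Realizes k x u = ∀ p q → (p , q) ∈ x → ∃[ v ] (u ∼[ k ] v × Path p v q)

  Realized : ℕ → Alphabet → Rel → Set
  Realized k B x = ∃[ u ] (Spells B u × Realizes k x u)

  Reach : Alphabet → Q → Q → Set
  Reach B p q = ∃[ w ] (All (_∈ B) w × Path p w q)

  -- Once decided, `Reach B` is itself one of the relations whose intersection is `star B`.
  star-reach : (∀ B p q → Dec (Reach B p q)) → ∀ B p q → (p , q) ∈ star B → Reach B p q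
  star-reach Reach? B p q pq = ∈⟪⟫⁻ _ (star-least B g (reflexive , extend) pq)
    where
    g : Rel
    g = ⟪ (λ (p , q) → Reach? B p q) ⟫
    reflexive : ∀ p → (p , p) ∈ g
    reflexive p = ∈⟪⟫⁺ _ ([] , [] , [])
    extend : ∀ p q r a → (p , q) ∈ g → a ∈ B → E q a r → (p , r) ∈ g
    extend p q r a pq a∈B e =
      let (w , B* , π) = ∈⟪⟫⁻ (λ (p , q) → Reach? B p q) pq
      in ∈⟪⟫⁺ _ (w ++ a ∷ [] , All.++⁺ B* (a∈B ∷ []) , π ++ᴾ (e ∷ []))

  ⊆⇒⊑ : ∀ (u v : List A) → (∀ {a} → a ∈ₗ u → a ∈ₗ v) → word u ⊑ word v
  ⊆⇒⊑ u v u⊆v i = let a∈v = u⊆v (List.∈-lookup i) in Any.index a∈v , Any.lookup-index a∈v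

  ∈-nest⁻ : ∀ n (x y : List A) → a ∈ₗ nest n x y [] → a ∈ₗ x ⊎ a ∈ₗ y
  ∈-nest⁻ (suc n) x y a∈ with List.∈-++⁻ x a∈
  ... | inj₁ a∈x = inj₁ a∈x
  ... | inj₂ a∈′ with List.∈-++⁻ (nest n x y []) a∈′
  ...   | inj₁ a∈n = ∈-nest⁻ n x y a∈n
  ...   | inj₂ a∈y = inj₂ a∈y

  spells-++ : Spells B u → Spells C v → Spells (B ∪ C) (u ++ v)
  spells-++ {u = u} sp sp′ a = mk⇔
    (λ a∈ → Sum.[ (λ a∈B → List.∈-++⁺ˡ (Equivalence.to (sp a) a∈B))
                , (λ a∈C → List.∈-++⁺ʳ u (Equivalence.to (sp′ a) a∈C)) ] (∈∪⁻ a∈))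
    (λ a∈ → ∈∪⁺ (Sum.map (Equivalence.from (sp a)) (Equivalence.from (sp′ a)) (List.∈-++⁻ u a∈)))

  spells-nest : ∀ n → Spells B u → Spells B v → Spells B (nest (suc n) u v [])
  spells-nest {u = u} {v} n sp sp′ a = mk⇔
    (λ a∈B → List.∈-++⁺ˡ (Equivalence.to (sp a) a∈B))
    (λ a∈ → Sum.[ Equivalence.from (sp a) , Equivalence.from (sp′ a) ] (∈-nest⁻ (suc n) u v a∈))

  -- `nest` adds layers on the outside, whereas `unroll` inserts new factors next to the centre.
  nest-inner : ∀ n (x y z : List A) → nest n x y (x ++ (z ++ y)) ≡ nest (suc n) x y z
  nest-inner zero    x y z = refl
  nest-inner (suc n) x y z = cong (λ m → x ++ (m ++ y)) (nest-inner n x y z)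

  nest-congʳ : ∀ {k} n {x y z z′ : List A} → z ∼[ k ] z′ → nest n x y z ∼[ k ] nest n x y z′
  nest-congʳ zero    e = e
  nest-congʳ (suc n) {x} {y} e = ++-cong-inner x y (nest-congʳ n e)

  realizes-++ : ∀ {k} → Realizes k x u → Realizes k y v → Realizes k (x · y) (u ++ v)
  realizes-++ ρ σ p r pr =
    let (q , pq , qr) = ∈·⁻ pr
        (u′ , e , π) = ρ p q pq
        (v′ , f , τ) = σ q r qr
    in u′ ++ v′ , ++-cong e f , π ++ᴾ τ

  -- Since e s ≡ e and t f ≡ f, arbitrarily many copies of words realizing
  -- s and t can be inserted around the word read between e and f.
  unroll : ∀ {k} {u x y v : List A} → e · s ≡ e → t · f ≡ f →
           Realizes k e u → Realizes k s x → Realizes k t y → Realizes k f v →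
           ∀ n {p q q′ r} z → (p , q) ∈ e → Path q z q′ → (q′ , r) ∈ f →
           ∃[ m ] (u ++ (nest n x y z ++ v) ∼[ k ] m × Path p m r)
  unroll _ _ ρe _ _ ρf zero z pq π qr =
    let (u′ , eu , πu) = ρe _ _ pq
        (v′ , ev , πv) = ρf _ _ qr
    in u′ ++ (z ++ v′) , ++-cong eu (++-cong ∼-refl ev) , πu ++ᴾ (π ++ᴾ πv)
  unroll {k = k} {u} {x} {y} {v} es tf ρe ρs ρt ρf (suc n) {p} {q} {q′} {r} z pq π qr =
    let (_ , pq₀ , q₀q) = ∈·⁻ (subst ((p , q) ∈_) (sym es) pq)
        (_ , q′q₁ , q₁r) = ∈·⁻ (subst ((q′ , r) ∈_) (sym tf) qr)
        (x′ , ex , πx) = ρs _ _ q₀q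
        (y′ , ey , πy) = ρt _ _ q′q₁
        (m , em , πm) = unroll es tf ρe ρs ρt ρf n (x′ ++ (z ++ y′)) pq₀
                          (πx ++ᴾ (π ++ᴾ πy)) q₁r
        inner : nest (suc n) x y z ∼[ k ] nest n x y (x′ ++ (z ++ y′))
        inner = subst (λ c → c ∼[ k ] nest n x y (x′ ++ (z ++ y′)))
          (nest-inner n x y z) (nest-congʳ n (++-cong ex (++-cong ∼-refl ey)))
    in m , ∼-trans (++-cong-inner u v inner) em , πm

  -- For the rule `stable`, one word with an empty centre is fixed in advance. Each pair then has
  -- its own centre z over B, which may replace the empty one because the surrounding copies of x
  -- and y hide it from k moves.
  realized : (∀ B p q → Dec (Reach B p q)) → ∀ k → Closed (Realized k)
  realized Reach? k = record
    { unit = [] , (λ a → mk⇔ (λ a∈ → contradiction a∈ ∉∅) (λ ()))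
           , (λ p q pq → [] , ∼-refl , subst (Path p []) (∈identity⁻ pq) [])
    ; letter = λ a → a ∷ []
           , (λ b → mk⇔ (λ b∈ → here (∈⁅⁆⁻ b∈)) (λ { (here refl) → ∈⁅⁆ }))
           , (λ p q pq → a ∷ [] , ∼-refl , ∈step⁻ pq ∷ [])
    ; product = λ B C x y (u , sp , ρ) (v , sp′ , σ) → u ++ v , spells-++ sp sp′ , realizes-++ ρ σ
    ; stable = λ C B D e s t f (u , sp-u , ρ-e) (x , sp-x , ρ-s) (y , sp-y , ρ-t)
               (v , sp-v , ρ-f) es tf →
        -- `suc k` layers are what `nest-cong` requires at level k. As there is at least one layer,
        -- the letters of B all occur although the centre is empty.
        u ++ (nest (suc k) x y [] ++ v)
      , spells-++ sp-u (spells-++ (spells-nest k sp-x sp-y) sp-v)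
      , λ p r pr →
          let (q , pq , qr) = ∈·⁻ pr
              (q′ , qq′ , q′r) = ∈·⁻ qr
              (z , B* , π) = star-reach Reach? B q q′ qq′
              (m , em , πm) = unroll es tf ρ-e ρ-s ρ-t ρ-f (suc k) z pq π q′r
              to-x : ∀ {a} → a ∈ B → a ∈ₗ x
              to-x = Equivalence.to (sp-x _)
              to-y : ∀ {a} → a ∈ B → a ∈ₗ y
              to-y = Equivalence.to (sp-y _)
              middle : nest (suc k) x y [] ∼[ k ] nest (suc k) x y z
              middle = nest-cong (suc k) k x y [] z
                (⊆⇒⊑ x y (to-y ∘ Equivalence.from (sp-x _)))
                (⊆⇒⊑ y x (to-x ∘ Equivalence.from (sp-y _)))
                (λ ())
                (⊆⇒⊑ z x (λ a∈z → to-x (All.lookup B* a∈z)))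
                (ℕ.n<1+n k)
          in m , ∼-trans (++-cong-inner u v middle) em , πm
    }

  -- Reachability and realizability are both treated as decided, at the price of a double negation;
  -- this makes `generated-least` applicable.
  generated-realized : ∀ k → ¬ ¬ (∀ {B x} → Generated B x → Realized k B x)
  generated-realized k ¬all =
    ¬¬-decidable (λ (B , p , q) → Reach B p q) λ Reach? →
    ¬¬-decidable (λ (B , x) → Realized k B x) λ Realized? →
    ¬all (generated-least (λ B x → Realized? (B , x)) (realized (λ B p q → Reach? (B , p , q)) k))

  -- Covers with generated imprints

  -- The rule `stable` wants s and t with exactly the same alphabet; for contexts and imprints an
  -- upper bound is enough.
  GeneratedIn : Alphabet → Rel → Set
  GeneratedIn U x = ∃[ C ] (C ⊆ U × Generated C x)

  opaque
    GeneratedIn? : ∀ U x → Dec (GeneratedIn U x)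
    GeneratedIn? U x = exists? (λ C → C ⊆? U ×-dec Generated? C x)

  open Closed generated

  in-identity : GeneratedIn U identity
  in-identity = ∅ , ∅-⊆ , unit

  in-step : a ∈ U → GeneratedIn U (step a)
  in-step {a} a∈U = ⁅ a ⁆ , (λ b b∈ → subst (_∈ _) (sym (∈⁅⁆⁻ b∈)) a∈U) , letter a

  in-product : GeneratedIn U x → GeneratedIn U y → GeneratedIn U (x · y)
  in-product (B , B⊆U , g) (C , C⊆U , h) = B ∪ C , ∪-⊆ B⊆U C⊆U , product B C _ _ g h

  -- The imprint is an upper bound for the relation induced by the words of the language. It has to
  -- be generated only when placed between the contexts e and f.
  record Piece (U : Alphabet) (e f : Rel) : Set where
    field
      formula   : Formula A 2
      sentence  : Sentence formula
      imprint   : Rel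
      imprinted : ∀ {w p q} → w ⊨ formula → Path p w q → (p , q) ∈ imprint
      inside    : GeneratedIn U (e · imprint · f)

  open Piece

  -- B is the alphabet of the words to be covered and shrinks in the recursion; U bounds the
  -- contexts as well, which may use letters outside B.
  Cover : (U B : Alphabet) (e f : Rel) → Set
  Cover U B e f =
    Σ[ Ps ∈ List (Piece U e f) ] (∀ {w} → All (_∈ B) w → Any (λ P → w ⊨ formula P) Ps)

  letters : List A
  letters = map (Finite.element finite-A) (List.allFin _)

  ∈-letters : ∀ a → a ∈ₗ letters
  ∈-letters a = subst (_∈ₗ letters) (element-index a)
    (List.∈-map⁺ element (List.∈-allFin (index a)))
    where open Finite finite-A using (element; index; element-index)

  letters-outside : Alphabet → List A
  letters-outside B = List.filter (λ a → ¬? (a ∈? B)) letters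

  -- The sentence says only which letters do not occur; membership in B is recovered from its
  -- decidability.
  All-avoid⇔ : ∀ B → All (_∈ B) w ⇔ w ⊨ avoid (letters-outside B)
  All-avoid⇔ B = mk⇔
    (λ B* → avoid⁺ (letters-outside B) (All.map
      (λ b∈B → All.map (λ { a∉B refl → a∉B b∈B }) (All.all-filter ∉B? letters))
      B*))
    (λ p → All.map
      (λ {b} b≢ → decidable-stable (b ∈? B) λ b∉B →
        All.lookup b≢ (List.∈-filter⁺ ∉B? (∈-letters b) b∉B) refl)
      (avoid⁻ (letters-outside B) p))
    where
    ∉B? = λ a → ¬? (a ∈? B)

  stable-cover : B ⊆ U → GeneratedIn U e → GeneratedIn U f → Generated B s → Generated B t →
                 e · s ≡ e → t · f ≡ f → Cover U B e f
  stable-cover {B} {U} {e} {f} {s} {t} B⊆U (C , C⊆U , ge) (D , D⊆U , gf) gs gt es tf =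
    record
      { formula   = avoid (letters-outside B)
      ; sentence  = sentence-avoid (letters-outside B)
      ; imprint   = star B
      ; imprinted = λ p → star-path (Equivalence.from (All-avoid⇔ B) p)
      ; inside    = C ∪ B ∪ D , ∪-⊆ C⊆U (∪-⊆ B⊆U D⊆U) , stable C B D e s t f ge gs gt gf es tf
      } ∷ []
    , λ B* → here (Equivalence.to (All-avoid⇔ B) B*)

  -- Cutting at a: P covers the part without a, and the remaining part is
  -- covered relative to a context that absorbs the imprint of P and a.
  glue-left : ∀ a (P : Piece B identity identity) →
              Piece U (e · imprint P · step a) f → Piece U e f
  glue-left {e = e} {f} a P P′ = record
    { formula   = cut left a (formula P) (formula P′)
    ; sentence  = sentence-cut left a (formula P) (formula P′) (sentence P) (sentence P′)
    ; imprint   = (imprint P · step a) · imprint P′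
    ; imprinted = λ p π → imprinted′ (cut-sound _≟_ left {φ = formula P} {formula P′} p) π
    ; inside    = subst (GeneratedIn _) eq (inside P′)
    }
    where
    T = imprint P · step a
    eq : (e · T) · (imprint P′ · f) ≡ e · ((T · imprint P′) · f)
    eq = trans (·-assoc e T _) (cong (e ·_) (sym (·-assoc T (imprint P′) f)))
    imprinted′ : ∀ {w p q} →
                 Σ[ c ∈ Cut left a w ] (Cut.before c ⊨ formula P × Cut.after c ⊨ formula P′) →
                 Path p w q → (p , q) ∈ T · imprint P′
    imprinted′ (⟨_,_⟩ {u} refl _ , m , n) π with split-path u π
    ... | _ , ρ , ε ∷ σ = ∈·⁺ (∈·⁺ (imprinted P m ρ) (∈step⁺ ε)) (imprinted P′ n σ)

  glue-right : ∀ a (P : Piece B identity identity) →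
               Piece U e ((step a · imprint P) · f) → Piece U e f
  glue-right {e = e} {f} a P P′ = record
    { formula   = cut right a (formula P) (formula P′)
    ; sentence  = sentence-cut right a (formula P) (formula P′) (sentence P) (sentence P′)
    ; imprint   = imprint P′ · (step a · imprint P)
    ; imprinted = λ p π → imprinted′ (cut-sound _≟_ right {φ = formula P} {formula P′} p) π
    ; inside    = subst (GeneratedIn _) eq (inside P′)
    }
    where
    T = step a · imprint P
    eq : e · (imprint P′ · (T · f)) ≡ e · ((imprint P′ · T) · f)
    eq = cong (e ·_) (sym (·-assoc (imprint P′) T f))
    imprinted′ : ∀ {w p q} →
                 Σ[ c ∈ Cut right a w ] (Cut.after c ⊨ formula P × Cut.before c ⊨ formula P′) →
                 Path p w q → (p , q) ∈ imprint P′ · T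
    imprinted′ (⟨_,_⟩ {u} refl _ , m , n) π with split-path u π
    ... | _ , ρ , ε ∷ σ = ∈·⁺ (imprinted P′ n ρ) (∈·⁺ (∈step⁺ ε) (imprinted P m σ))

  -- With the side as a parameter, `cut-cover` treats cuts at the first and at the last a alike.
  Continuation : Side → A → (U B : Alphabet) (e f : Rel) → Piece B identity identity → Set
  Continuation d a U B e f P = Σ[ Ps ∈ List (Piece U e f) ] (∀ {u v} →
    All (_≢ a) (near d u v) → near d u v ⊨ formula P → All (_∈ B) (far d u v) →
    Any (λ P′ → u ++ a ∷ v ⊨ formula P′) Ps)

  -- A word over B either lacks a or has a cut, and then its near factor lies over the smaller
  -- alphabet. Each piece covering near factors brings its own cover for the far factors, since its
  -- imprint enters their context.
  cut-cover : ∀ d a → Cover U (B ∖ ⁅ a ⁆) e f → Cover B (B ∖ ⁅ a ⁆) identity identity →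
              (∀ P → Continuation d a U B e f P) → Cover U B e f
  cut-cover {U} {B} {e} {f} d a (Ps , Ps-cover) (Is , Is-cover) continue =
      Ps ++ List.concatMap (proj₁ ∘ continue) Is
    , λ {w} B* → covered B* (find-cut _≟_ d a w)
    where
    without : ∀ {u} → All (_∈ B) u → All (_≢ a) u → All (_∈ B ∖ ⁅ a ⁆) u
    without B* a∉ = All.zipWith (λ (b∈B , b≢a) → ∈∖⁺ b∈B (b≢a ∘ ∈⁅⁆⁻)) (B* , a∉)
    halves : ∀ d u v → All (_∈ B) (u ++ a ∷ v) →
             All (_∈ B) (near d u v) × All (_∈ B) (far d u v)
    halves left  u v B* = All.++⁻ˡ u B* , All.tail (All.++⁻ʳ u B*)
    halves right u v B* = All.tail (All.++⁻ʳ u B*) , All.++⁻ˡ u B*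
    covered : ∀ {w} → All (_∈ B) w → All (_≢ a) w ⊎ Cut d a w →
              Any (λ P → w ⊨ formula P) (Ps ++ List.concatMap (proj₁ ∘ continue) Is)
    covered B* (inj₁ a∉w) = Any.++⁺ˡ (Ps-cover (without B* a∉w))
    covered B* (inj₂ (⟨_,_⟩ {u} {v} refl a∉)) =
      let (near* , far*) = halves d u v B*
      in Any.++⁺ʳ Ps (Any.concat⁺ (Any.map⁺
           (Any.map (λ {P} p → proj₂ (continue P) a∉ p far*) (Is-cover (without near* a∉)))))

  -- Lossy letters and stable contexts

  FixedWith : (Rel → Set) → Alphabet → A → Set
  FixedWith Fix B a = ∃[ C ] ∃[ s ] (C ⊆ B × a ∈ C × Generated C s × Fix s)

  -- Read `Fix s` as `e · s ≡ e`: after a generated factor over B that contains a, no further one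
  -- leads back to e. `Fix` is a parameter so as to serve the right context f too.
  Lossy : (Rel → Set) → Alphabet → Set
  Lossy Fix B = ∃[ a ] (a ∈ B × ¬ FixedWith Fix B a)

  Stable : (Rel → Set) → Alphabet → Set
  Stable Fix B = ∃[ s ] (Generated B s × Fix s)

  -- If no letter is lossy, every letter of B lies in the alphabet of some fixing relation over B.
  -- The product of these relations has alphabet exactly B and is still fixing.
  lossy-or-stable : (Fix : Rel → Set) → Decidable Fix → Fix identity →
                    (∀ {x y} → Fix x → Fix y → Fix (x · y)) → ∀ B → Lossy Fix B ⊎ Stable Fix B
  lossy-or-stable Fix Fix? fix-identity fix-product B = decide (exists? lossy?)
    where
    fixed? : Decidable (FixedWith Fix B)
    fixed? a = exists? λ C → exists? λ s → C ⊆? B ×-dec a ∈? C ×-dec Generated? C s ×-dec Fix? s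
    lossy? : Decidable (λ a → a ∈ B × ¬ FixedWith Fix B a)
    lossy? a = a ∈? B ×-dec ¬? (fixed? a)
    collect : ¬ Lossy Fix B → (as : List A) →
              ∃[ C ] ∃[ s ] (C ⊆ B × (∀ {a} → a ∈ₗ as → a ∈ B → a ∈ C) × Generated C s × Fix s)
    collect ¬lossy [] = ∅ , identity , ∅-⊆ , (λ ()) , unit , fix-identity
    collect ¬lossy (a ∷ as) with collect ¬lossy as | a ∈? B
    ... | C , s , C⊆B , complete , g , fix | no a∉B =
        C , s , C⊆B
      , (λ { (here refl) a∈B → contradiction a∈B a∉B ; (there b∈) → complete b∈ })
      , g , fix
    ... | C , s , C⊆B , complete , g , fix | yes a∈B =
      let (D , t , D⊆B , a∈D , h , fix′) =
            decidable-stable (fixed? a) (λ ¬fixed → ¬lossy (a , a∈B , ¬fixed))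
      in C ∪ D , s · t , ∪-⊆ C⊆B D⊆B
       , (λ { (here refl) _ → ∈∪⁺ (inj₂ a∈D) ; (there b∈) b∈B → ∈∪⁺ (inj₁ (complete b∈ b∈B)) })
       , product C D s t g h , fix-product fix fix′

    decide : Dec (Lossy Fix B) → Lossy Fix B ⊎ Stable Fix B
    decide (yes lossy) = inj₁ lossy
    decide (no ¬lossy) =
      let (C , s , C⊆B , complete , g , fix) = collect ¬lossy letters
          C≡B : C ≡ B
          C≡B = ⊆-antisym C⊆B (λ b → complete (∈-letters b))
      in inj₂ (s , subst (λ C → Generated C s) C≡B g , fix)

  -- Ideals and the recursion for covers

  opaque
    rightIdeal leftIdeal : Alphabet → Rel → Sub Rel
    rightIdeal B e = ⟪ (λ x → exists? (λ r → GeneratedIn? B r ×-dec (e · r ≟ x))) ⟫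
    leftIdeal  B f = ⟪ (λ x → exists? (λ r → GeneratedIn? B r ×-dec (r · f ≟ x))) ⟫

    ∈rightIdeal⁺ : ∀ e r → GeneratedIn B r → e · r ∈ rightIdeal B e
    ∈rightIdeal⁺ e r g = ∈⟪⟫⁺ _ (r , g , refl)

    ∈leftIdeal⁺ : ∀ f r → GeneratedIn B r → r · f ∈ leftIdeal B f
    ∈leftIdeal⁺ f r g = ∈⟪⟫⁺ _ (r , g , refl)

    ∈rightIdeal⁻ : x ∈ rightIdeal B e → ∃[ r ] (GeneratedIn B r × e · r ≡ x)
    ∈rightIdeal⁻ {B = B} {e} =
      ∈⟪⟫⁻ (λ x → exists? (λ r → GeneratedIn? B r ×-dec (e · r ≟ x)))

    ∈leftIdeal⁻ : x ∈ leftIdeal B f → ∃[ r ] (GeneratedIn B r × r · f ≡ x)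
    ∈leftIdeal⁻ {B = B} {f} =
      ∈⟪⟫⁻ (λ x → exists? (λ r → GeneratedIn? B r ×-dec (r · f ≟ x)))

  -- The inclusion absorbs y into the multiplier. It is strict because e belongs to its own ideal
  -- through the identity but, by assumption, not to that of `e · y`.
  rightIdeal-< : GeneratedIn B y → ¬ (∃[ r ] (GeneratedIn B r × (e · y) · r ≡ e)) →
                 ∣ rightIdeal B (e · y) ∣ ℕ.< ∣ rightIdeal B e ∣
  rightIdeal-< {B} {y} {e} gy lost = ⊂⇒∣∣< shrink e
    (subst (_∈ rightIdeal B e) (·-identityʳ e) (∈rightIdeal⁺ e identity in-identity))
    (lost ∘ ∈rightIdeal⁻)
    where
    shrink : ∀ x → x ∈ rightIdeal B (e · y) → x ∈ rightIdeal B e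
    shrink x x∈ with ∈rightIdeal⁻ x∈
    ... | r , gr , refl = subst (_∈ rightIdeal B e) (sym (·-assoc e y r))
      (∈rightIdeal⁺ e (y · r) (in-product gy gr))

  leftIdeal-< : GeneratedIn B y → ¬ (∃[ r ] (GeneratedIn B r × r · (y · f) ≡ f)) →
                ∣ leftIdeal B (y · f) ∣ ℕ.< ∣ leftIdeal B f ∣
  leftIdeal-< {B} {y} {f} gy lost = ⊂⇒∣∣< shrink f
    (subst (_∈ leftIdeal B f) (·-identityˡ f) (∈leftIdeal⁺ f identity in-identity))
    (lost ∘ ∈leftIdeal⁻)
    where
    shrink : ∀ x → x ∈ leftIdeal B (y · f) → x ∈ leftIdeal B f
    shrink x x∈ with ∈leftIdeal⁻ x∈
    ... | r , gr , refl = subst (_∈ leftIdeal B f) (·-assoc r y f)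
      (∈leftIdeal⁺ f (r · y) (in-product gr gy))

  ∖-< : a ∈ B → ∣ B ∖ ⁅ a ⁆ ∣ ℕ.< ∣ B ∣
  ∖-< {a} a∈B = ⊂⇒∣∣< (λ b b∈ → proj₁ (∈∖⁻ b∈)) a a∈B (λ a∈ → proj₂ (∈∖⁻ a∈) ∈⁅⁆)

  widen : B ⊆ U → GeneratedIn B x → GeneratedIn U x
  widen B⊆U (C , C⊆B , g) = C , (λ c c∈ → B⊆U c (C⊆B c c∈)) , g

  imprint-in : (P : Piece B identity identity) → GeneratedIn B (imprint P)
  imprint-in P = subst (GeneratedIn _) (trans (·-identityˡ _) (·-identityʳ _)) (inside P)

  cover-left : (a∈B : a ∈ B) → ¬ FixedWith (λ s → e · s ≡ e) B a → B ⊆ U → GeneratedIn U e →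
               Cover U (B ∖ ⁅ a ⁆) e f → Cover B (B ∖ ⁅ a ⁆) identity identity →
               (∀ e′ → ∣ rightIdeal B e′ ∣ ℕ.< ∣ rightIdeal B e ∣ → GeneratedIn U e′ →
                Cover U B e′ f) →
               Cover U B e f
  cover-left {a} {B} {e} {U} {f} a∈B lossy B⊆U ge without-a inner recurse =
    cut-cover left a without-a inner continue
    where
    module _ (P : Piece B identity identity) where
      T : Rel
      T = imprint P · step a
      T-in : GeneratedIn B T
      T-in = in-product (imprint-in P) (in-step a∈B)
      -- If r led from `e · T` back to e, then `T · r` would fix e, and its alphabet contains a; but
      -- a is lossy.
      lost : ¬ (∃[ r ] (GeneratedIn B r × (e · T) · r ≡ e))
      lost (r , (D , D⊆B , gr) , eq) = lossy
        ( (proj₁ (imprint-in P) ∪ ⁅ a ⁆) ∪ D , T · r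
        , ∪-⊆ (proj₁ (proj₂ T-in)) D⊆B
        , ∈∪⁺ (inj₁ (∈∪⁺ (inj₂ ∈⁅⁆)))
        , product _ D T r (proj₂ (proj₂ T-in)) gr
        , trans (sym (·-assoc e T r)) eq )
      rest : Cover U B (e · T) f
      rest = recurse (e · T) (rightIdeal-< T-in lost) (in-product ge (widen B⊆U T-in))
      continue : Continuation left a U B e f P
      continue = map (glue-left a P) (proj₁ rest)
        , λ {u} {v} a∉ p B* → Any.map⁺ (Any.map
            (λ {P′} q → cut⁺ u a v left a∉ {formula P} {formula P′} p q) (proj₂ rest B*))

  cover-right : (a∈B : a ∈ B) → ¬ FixedWith (λ s → s · f ≡ f) B a → B ⊆ U → GeneratedIn U f →
                Cover U (B ∖ ⁅ a ⁆) e f → Cover B (B ∖ ⁅ a ⁆) identity identity →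
                (∀ f′ → ∣ leftIdeal B f′ ∣ ℕ.< ∣ leftIdeal B f ∣ → GeneratedIn U f′ →
                 Cover U B e f′) →
                Cover U B e f
  cover-right {a} {B} {f} {U} {e} a∈B lossy B⊆U gf without-a inner recurse =
    cut-cover right a without-a inner continue
    where
    module _ (P : Piece B identity identity) where
      T : Rel
      T = step a · imprint P
      T-in : GeneratedIn B T
      T-in = in-product (in-step a∈B) (imprint-in P)
      -- Dually, `r · T` would fix f with an alphabet that contains a.
      lost : ¬ (∃[ r ] (GeneratedIn B r × r · (T · f) ≡ f))
      lost (r , (D , D⊆B , gr) , eq) = lossy
        ( D ∪ (⁅ a ⁆ ∪ proj₁ (imprint-in P)) , r · T
        , ∪-⊆ D⊆B (proj₁ (proj₂ T-in))
        , ∈∪⁺ (inj₂ (∈∪⁺ (inj₁ ∈⁅⁆)))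
        , product D _ r T gr (proj₂ (proj₂ T-in))
        , trans (·-assoc r T f) eq )
      rest : Cover U B e (T · f)
      rest = recurse (T · f) (leftIdeal-< T-in lost) (in-product (widen B⊆U T-in) gf)
      continue : Continuation right a U B e f P
      continue = map (glue-right a P) (proj₁ rest)
        , λ {u} {v} a∉ p B* → Any.map⁺ (Any.map
            (λ {P′} q → cut⁺ u a v right a∉ {formula P} {formula P′} p q) (proj₂ rest B*))

  -- A cut shrinks the ideal of one context and leaves the other context as it is, so the sum drops
  -- on either side.
  measure : Alphabet → Rel → Rel → ℕ
  measure B e f = ∣ rightIdeal B e ∣ ℕ.+ ∣ leftIdeal B f ∣

  lossy-or-stableˡ : ∀ e B → Lossy (λ s → e · s ≡ e) B ⊎ Stable (λ s → e · s ≡ e) B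
  lossy-or-stableˡ e = lossy-or-stable _ (λ s → e · s ≟ e) (·-identityʳ e)
    (λ {s} {t} es et → trans (sym (·-assoc e s t)) (trans (cong (_· t) es) et))

  lossy-or-stableʳ : ∀ f B → Lossy (λ s → s · f ≡ f) B ⊎ Stable (λ s → s · f ≡ f) B
  lossy-or-stableʳ f = lossy-or-stable _ (λ s → s · f ≟ f) (·-identityˡ f)
    (λ {s} {t} sf tf → trans (·-assoc s t f) (trans (cong (s ·_) tf) sf))

  -- Inner recursion, for fixed B: m bounds the measure of the contexts. Covers over smaller
  -- alphabets are supplied by the outer recursion `cover`.
  cover-step : ∀ B →
    (∀ {C} U e f → ∣ C ∣ ℕ.< ∣ B ∣ → C ⊆ U → GeneratedIn U e → GeneratedIn U f → Cover U C e f) →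
    ∀ m {U e f} → measure B e f ℕ.< m → B ⊆ U → GeneratedIn U e → GeneratedIn U f → Cover U B e f
  cover-step B smaller (suc m) {U} {e} {f} μ<m B⊆U ge gf =
    decide (lossy-or-stableˡ e B) (lossy-or-stableʳ f B)
    where
    ∖-⊆ : ∀ {a} → B ∖ ⁅ a ⁆ ⊆ B
    ∖-⊆ b b∈ = proj₁ (∈∖⁻ b∈)
    without : ∀ {a} U e f → a ∈ B → B ⊆ U → GeneratedIn U e → GeneratedIn U f →
              Cover U (B ∖ ⁅ a ⁆) e f
    without U e f a∈B B⊆U = smaller U e f (∖-< a∈B) (λ b b∈ → B⊆U b (∖-⊆ b b∈))
    decide : Lossy (λ s → e · s ≡ e) B ⊎ Stable (λ s → e · s ≡ e) B →
             Lossy (λ s → s · f ≡ f) B ⊎ Stable (λ s → s · f ≡ f) B → Cover U B e f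
    decide (inj₂ (s , gs , es)) (inj₂ (t , gt , tf)) = stable-cover B⊆U ge gf gs gt es tf
    decide (inj₁ (a , a∈B , lossy)) _ =
      cover-left a∈B lossy B⊆U ge (without U e f a∈B B⊆U ge gf)
        -- Near factors are covered in trivial contexts, so that the imprint of a piece is generated
        -- by itself and can be moved into the context.
        (without B identity identity a∈B (λ _ → id) in-identity in-identity)
        (λ e′ shrinks ge′ → cover-step B smaller m
          (ℕ.<-≤-trans (ℕ.+-monoˡ-< _ shrinks) (ℕ.s≤s⁻¹ μ<m)) B⊆U ge′ gf)
    decide (inj₂ _) (inj₁ (a , a∈B , lossy)) =
      cover-right a∈B lossy B⊆U gf (without U e f a∈B B⊆U ge gf)
        (without B identity identity a∈B (λ _ → id) in-identity in-identity)
        (λ f′ shrinks gf′ → cover-step B smaller m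
          (ℕ.<-≤-trans (ℕ.+-monoʳ-< _ shrinks) (ℕ.s≤s⁻¹ μ<m)) B⊆U ge gf′)

  cover : ∀ n {B} U e f → ∣ B ∣ ℕ.< n → B ⊆ U → GeneratedIn U e → GeneratedIn U f → Cover U B e f
  cover (suc n) {B} U e f |B|<n = cover-step B
    (λ U e f |C|<|B| → cover n U e f (ℕ.<-≤-trans |C|<|B| (ℕ.s≤s⁻¹ |B|<n)))
    _ (ℕ.n<1+n _)

  -- Deciding coverability

  recognized : Ends Q → Language A
  recognized ends w = ∃[ p ] ∃[ q ] (initial p × final q × Path p w q)
    where open Ends ends

  Hits : Rel → Ends Q → Set
  Hits x ends = ∃[ p ] ∃[ q ] (initial p × final q × (p , q) ∈ x)
    where open Ends ends

  Hits? : ∀ x ends → Dec (Hits x ends)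
  Hits? x ends = exists? λ p → exists? λ q → initial? p ×-dec final? q ×-dec (p , q) ∈? x
    where open Ends ends

  Obstruction : Ends Q → List (Ends Q) → Set₁
  Obstruction L Ls = ∃[ B ] ∃[ x ] (Generated B x × Hits x L × All (Hits x) Ls)

  opaque
    Obstruction? : ∀ L Ls → Dec (Obstruction L Ls)
    Obstruction? L Ls = exists? λ B → exists? λ x →
      Generated? B x ×-dec Hits? x L ×-dec All.all? (Hits? x) Ls

  Saturated : ℕ → Language A → Set
  Saturated k K = ∀ {u v} → u ∼[ k ] v → u ∈ᴸ K → v ∈ᴸ K

  -- A cover is finite, so the largest of the depths serves all its members: equivalence at a higher
  -- level is finer.
  saturated-together : ∀ {Ks : List (Language A)} → All FO² Ks → ∃[ k ] All (Saturated k) Ks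
  saturated-together []       = 0 , []
  saturated-together (d ∷ ds) =
    let (k , sat)  = FO²-saturated d
        (l , sats) = saturated-together ds
    in k ⊔ l , (λ e → sat (∼-mono (ℕ.m≤m⊔n k l) e))
             ∷ All.map (λ s {_} {_} e → s (∼-mono (ℕ.m≤n⊔m k l) e)) sats

  -- The word read along the pair that hits L lies in some K of the cover. By saturation K also
  -- contains the equivalent words read along the pairs that hit the other languages, so K is
  -- disjoint from none of them. The goal being absurd, the realizing word may be assumed.
  obstruction⇒¬coverable : ∀ L Ls → Obstruction L Ls →
                           ¬ Coverable FO² (recognized L) (map recognized Ls)
  obstruction⇒¬coverable L Ls (B , x , g , (p , q , ip , fq , pq) , hits)
                         (Ks , (definable , covers) , separates) =
    let (k , saturated) = saturated-together definable
    in generated-realized k λ realize →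
      let (u , _ , ρ) = realize g
          (v , u∼v , π) = ρ p q pq
          in-K = covers (p , q , ip , fq , π)
          (K , K∈ , v∈K) = find in-K
          escapes : ∀ {e} → Hits x e → ¬ (K ⊥ᴸ recognized e)
          escapes (p′ , q′ , ip′ , fq′ , pq′) K⊥ =
            let (v′ , u∼v′ , π′) = ρ p′ q′ pq′
            in K⊥ ( All.lookup saturated K∈ (∼-trans (∼-sym u∼v) u∼v′) v∈K
                  , p′ , q′ , ip′ , fq′ , π′ )
      in All.All¬⇒¬Any (All.map⁺ (All.map (λ {e} → escapes {e}) hits)) (All.lookup separates K∈)

  all-letters : Alphabet
  all-letters = ⟪ (λ _ → yes tt) ⟫

  -- Of a cover of all words, only the pieces whose imprint hits L are kept. Such an imprint is
  -- generated, so without an obstruction it fails to hit one of the other languages, and the piece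
  -- is disjoint from that language.
  ¬obstruction⇒coverable : ∀ L Ls → ¬ Obstruction L Ls →
                           Coverable FO² (recognized L) (map recognized Ls)
  ¬obstruction⇒coverable L Ls ¬obstruction =
      map lang Qs
    , ( All.map⁺ (All.universal (λ P → formula P , sentence P , λ w → mk⇔ id id) Qs)
      , λ {w} → covers {w} )
    , All.map⁺ (All.map (λ {P} → separated {P}) (All.all-filter hits? Ps))
    where
    whole : Cover all-letters all-letters identity identity
    whole = cover _ all-letters identity identity (ℕ.n<1+n _) (λ _ → id) in-identity in-identity
    Ps = proj₁ whole
    hits? = λ P → Hits? (imprint P) L
    Qs = List.filter hits? Ps
    lang : Piece all-letters identity identity → Language A
    lang P w = w ⊨ formula P
    covers : ∀ {w} → w ∈ᴸ recognized L → Any (w ∈ᴸ_) (map lang Qs)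
    covers {w} (p , q , ip , fq , π) =
      let (P , P∈ , w⊨P) = find (proj₂ whole (All.universal (λ _ → ∈⟪⟫⁺ _ tt) w))
      in Any.map⁺ (lose (List.∈-filter⁺ hits? P∈ (p , q , ip , fq , imprinted P w⊨P π)) w⊨P)
    separated : ∀ {P} → Hits (imprint P) L → Any (lang P ⊥ᴸ_) (map recognized Ls)
    separated {P} hit = Any.map⁺ (Any.map
      (λ { ¬hit (w⊨P , p , q , ip , fq , π) → ¬hit (p , q , ip , fq , imprinted P w⊨P π) })
      (All.¬All⇒Any¬ (Hits? (imprint P)) Ls λ hits →
        let (C , _ , g) = imprint-in P in ¬obstruction (C , imprint P , g , hit , hits)))

  coverable? : ∀ L Ls → Dec (Coverable FO² (recognized L) (map recognized Ls))
  coverable? L Ls with Obstruction? L Ls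
  ... | yes obstruction = no (obstruction⇒¬coverable L Ls obstruction)
  ... | no ¬obstruction = yes (¬obstruction⇒coverable L Ls ¬obstruction)

-- Automata from presentations

infix 4 _≋_

_≋_ : Language A → Language A → Set
K ≋ L = ∀ w → w ∈ᴸ K ⇔ w ∈ᴸ L

record Automata (A : Set) (Ps : List (Presentation A)) : Set₁ where
  field
    State         : Set
    finite-State  : Finite State
    Edge          : State → A → State → Set
    Edge?         : ∀ p a q → Dec (Edge p a q)
    ends          : List (Ends State)

  open Runs A State Edge public

  Accepts : Ends State → Language A
  Accepts e w = ∃[ p ] ∃[ q ] (Ends.initial e p × Ends.final e q × Path p w q)

  field
    correct : Listwise.Pointwise (λ P e → language P ≋ Accepts e) Ps ends

module _ {A : Set} where

  empty : Automata A []
  empty = record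
    { State = Fin 0 ; finite-State = finite-Fin ; Edge = λ _ _ _ → ⊥ ; Edge? = λ _ _ _ → no id
    ; ends = [] ; correct = [] }

  nfa-automata : (N : NFA A) → Automata A (nfa N ∷ [])
  nfa-automata N = record
    { State = Fin states ; finite-State = finite-Fin
    ; Edge = λ p a q → q ∈ˢ δ p a ; Edge? = λ p a q → q Subset.∈? δ p a
    ; ends = record { initial? = Subset._∈? initial ; final? = Subset._∈? final } ∷ []
    ; correct = (λ w → mk⇔
        (λ (p , p∈ , acc) → let (q , q∈ , π) = accepts⁺ w acc in p , q , p∈ , q∈ , π)
        (λ (p , q , p∈ , q∈ , π) → p , p∈ , accepts⁻ q∈ π)) ∷ []
    }
    where
    open NFA N
    open Runs A (Fin states) (λ p a q → q ∈ˢ δ p a)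
    accepts⁺ : ∀ {p} w → AcceptsFrom p w → ∃[ q ] (q ∈ˢ final × Path p w q)
    accepts⁺ []      p∈ = _ , p∈ , []
    accepts⁺ (a ∷ w) (r , e , acc) = let (q , q∈ , π) = accepts⁺ w acc in q , q∈ , e ∷ π
    accepts⁻ : ∀ {p q w} → q ∈ˢ final → Path p w q → AcceptsFrom p w
    accepts⁻ q∈ []      = q∈
    accepts⁻ q∈ (e ∷ π) = _ , e , accepts⁻ q∈ π

  -- The right Cayley graph of the monoid, started at `ε`: the word w leads from m to `m ∙ ⟦ w ⟧`.
  morphism-automata : (α : FiniteMonoidMorphism A) → Automata A (morphism α ∷ [])
  morphism-automata α = record
    { State = Fin size ; finite-State = finite-Fin
    ; Edge = λ m a n → m ∙ ⟦ a ∷ [] ⟧ ≡ n ; Edge? = λ m a n → m ∙ ⟦ a ∷ [] ⟧ ≟ n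
    ; ends = record { initial? = _≟ ε ; final? = Subset._∈? accepting } ∷ []
    ; correct = (λ w → mk⇔
        (λ acc → ε , ⟦ w ⟧ , refl , acc , subst (Path ε w) (identityˡ _) (run ε w))
        (λ { (_ , _ , refl , acc , π) →
             subst (_∈ˢ accepting) (trans (value π) (identityˡ _)) acc })) ∷ []
    }
    where
    open FiniteMonoidMorphism α
    open IsMonoid isMonoid using (identityˡ; identityʳ; assoc)
    open MonoidMorphisms.IsMonoidHomomorphism isHom using (homo; ε-homo)
    open Runs A (Fin size) (λ m a n → m ∙ ⟦ a ∷ [] ⟧ ≡ n)
    value : ∀ {m w n} → Path m w n → n ≡ m ∙ ⟦ w ⟧
    value {m} [] = sym (trans (cong (m ∙_) ε-homo) (identityʳ m))
    value {m} {a ∷ w} (refl ∷ π) =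
      trans (value π) (trans (assoc m _ _) (cong (m ∙_) (sym (homo (a ∷ []) w))))
    total : ∀ m w → ∃[ n ] Path m w n
    total m []      = m , []
    total m (a ∷ w) = let (n , π) = total (m ∙ ⟦ a ∷ [] ⟧) w in n , refl ∷ π
    run : ∀ m w → Path m w (m ∙ ⟦ w ⟧)
    run m w = let (n , π) = total m w in subst (Path m w) (value π) π

  listwise-mapʳ : ∀ {a b ℓ} {I : Set a} {J J′ : Set b} {R : I → J → Set ℓ} {S : I → J′ → Set ℓ}
                  {g : J → J′} → (∀ {i j} → R i j → S i (g j)) →
                  ∀ {is js} → Listwise.Pointwise R is js → Listwise.Pointwise S is (map g js)
  listwise-mapʳ h []       = []
  listwise-mapʳ h (r ∷ rs) = h r ∷ listwise-mapʳ h rs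

  union : ∀ {Ps Ps′} → Automata A Ps → Automata A Ps′ → Automata A (Ps ++ Ps′)
  union M N = record
    { State = M.State ⊎ N.State
    ; finite-State = finite-⊎ ⦃ M.finite-State ⦄ ⦃ N.finite-State ⦄
    ; Edge = Edge ; Edge? = Edge?
    ; ends = map ends₁ M.ends ++ map ends₂ N.ends
    ; correct = Listwise.++⁺
        (listwise-mapʳ (λ {_ e} c w → ⇔.trans (c w) (accepts₁ e w)) M.correct)
        (listwise-mapʳ (λ {_ e} c w → ⇔.trans (c w) (accepts₂ e w)) N.correct)
    }
    where
    module M = Automata M
    module N = Automata N

    Edge : M.State ⊎ N.State → A → M.State ⊎ N.State → Set
    Edge (inj₁ p) a (inj₁ q) = M.Edge p a q
    Edge (inj₂ p) a (inj₂ q) = N.Edge p a q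
    Edge _        a _        = ⊥

    Edge? : ∀ p a q → Dec (Edge p a q)
    Edge? (inj₁ p) a (inj₁ q) = M.Edge? p a q
    Edge? (inj₁ p) a (inj₂ q) = no id
    Edge? (inj₂ p) a (inj₁ q) = no id
    Edge? (inj₂ p) a (inj₂ q) = N.Edge? p a q

    open Runs A (M.State ⊎ N.State) Edge

    ends₁ : Ends M.State → Ends (M.State ⊎ N.State)
    ends₁ e = record
      { initial  = Sum.[ initial , (λ _ → ⊥) ]
      ; final    = Sum.[ final , (λ _ → ⊥) ]
      ; initial? = Sum.[ initial? , (λ _ → no id) ]
      ; final?   = Sum.[ final? , (λ _ → no id) ]
      }
      where open Ends e

    ends₂ : Ends N.State → Ends (M.State ⊎ N.State)
    ends₂ e = record
      { initial  = Sum.[ (λ _ → ⊥) , initial ]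
      ; final    = Sum.[ (λ _ → ⊥) , final ]
      ; initial? = Sum.[ (λ _ → no id) , initial? ]
      ; final?   = Sum.[ (λ _ → no id) , final? ]
      }
      where open Ends e

    path₁⁺ : ∀ {p w q} → M.Path p w q → Path (inj₁ p) w (inj₁ q)
    path₁⁺ M.[]      = []
    path₁⁺ (e M.∷ π) = e ∷ path₁⁺ π

    path₁⁻ : ∀ {p w q} → Path (inj₁ p) w (inj₁ q) → M.Path p w q
    path₁⁻ []                   = M.[]
    path₁⁻ (_∷_ {q = inj₁ _} e π) = e M.∷ path₁⁻ π

    path₂⁺ : ∀ {p w q} → N.Path p w q → Path (inj₂ p) w (inj₂ q)
    path₂⁺ N.[]      = []
    path₂⁺ (e N.∷ π) = e ∷ path₂⁺ π

    path₂⁻ : ∀ {p w q} → Path (inj₂ p) w (inj₂ q) → N.Path p w q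
    path₂⁻ []                   = N.[]
    path₂⁻ (_∷_ {q = inj₂ _} e π) = e N.∷ path₂⁻ π

    Accepts : Ends (M.State ⊎ N.State) → Language A
    Accepts e w = ∃[ p ] ∃[ q ] (Ends.initial e p × Ends.final e q × Path p w q)

    accepts₁ : ∀ e → M.Accepts e ≋ Accepts (ends₁ e)
    accepts₁ e w = mk⇔
      (λ (p , q , ip , fq , π) → inj₁ p , inj₁ q , ip , fq , path₁⁺ π)
      (λ { (inj₁ p , inj₁ q , ip , fq , π) → p , q , ip , fq , path₁⁻ π })

    accepts₂ : ∀ e → N.Accepts e ≋ Accepts (ends₂ e)
    accepts₂ e w = mk⇔
      (λ (p , q , ip , fq , π) → inj₂ p , inj₂ q , ip , fq , path₂⁺ π)
      (λ { (inj₂ p , inj₂ q , ip , fq , π) → p , q , ip , fq , path₂⁻ π })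

  automata : (Ps : List (Presentation A)) → Automata A Ps
  automata []                = empty
  automata (nfa N ∷ Ps)      = union (nfa-automata N) (automata Ps)
  automata (morphism α ∷ Ps) = union (morphism-automata α) (automata Ps)

  -- Transport along equality of languages

  any-⊥-resp : ∀ {a b} {I : Set a} {J : Set b} {K : Language A}
               {f : I → Language A} {g : J → Language A} {is js} →
               Listwise.Pointwise (λ i j → f i ≋ g j) is js →
               Any (K ⊥ᴸ_) (map f is) → Any (K ⊥ᴸ_) (map g js)
  any-⊥-resp (c ∷ cs) (here K⊥)   = here (λ {w} (w∈K , w∈) → K⊥ (w∈K , Equivalence.from (c w) w∈))
  any-⊥-resp (c ∷ cs) (there any) = there (any-⊥-resp cs any)

  coverable-resp : ∀ {a b} {I : Set a} {J : Set b} {L L′ : Language A}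
                   {f : I → Language A} {g : J → Language A} {is js} →
                   L ≋ L′ →
                   Listwise.Pointwise (λ i j → f i ≋ g j) is js →
                   Coverable FO² L (map f is) → Coverable FO² L′ (map g js)
  coverable-resp c cs (Ks , (definable , covers) , separates) =
      Ks , (definable , λ {w} w∈ → covers (Equivalence.from (c w) w∈))
    , All.map (any-⊥-resp cs) separates

corollary8p7 : (A : Set) (k : ℕ) → A ↔ Fin k →
    (L : Presentation A) (Ls : List (Presentation A)) →
    Dec (Coverable FO² (language L) (map language Ls))
corollary8p7 A k A↔Fin L Ls = decide (automata (L ∷ Ls))
  where
  decide : Automata A (L ∷ Ls) → Dec (Coverable FO² (language L) (map language Ls))
  -- All presentations share one state space; the first `Ends` belongs to L and the others to `Ls`.
  decide record { State = Q ; finite-State = finite-Q ; Edge = E ; Edge? = E?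
                ; ends = e ∷ es ; correct = c ∷ cs } =
    map′ (coverable-resp (λ w → ⇔.sym (c w)) (Listwise.symmetric (λ d w → ⇔.sym (d w)) cs))
         (coverable-resp c cs)
         (Automaton.coverable? A Q ⦃ record { code = A↔Fin } ⦄ ⦃ finite-Q ⦄ E E? e es)
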